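{- Let $p$ be a prime and $k$ a positive integer. Then $$\Psi_{p^k}(x)\equiv\left(x^2+4\right)^{\varphi(p^k)/2}\pmod p,$$ i.e., the two polynomials agree in $\mathbb{Z}_p[x]$.
   Context: $\varphi$ is Euler's totient function and $\mathbb{Z}_p$ is the field with $p$ elements. The Fibonacci polynomials are defined by $F_1(x)=1$, $F_2(x)=x$, and $F_n(x)=xF_{n-1}(x)+F_{n-2}(x)$ for $n\geq 3$. For $n\geq 2$, the $n$-th fibotomic polynomial $\Psi_n(x)\in\mathbb{Z}[x]$ is the product of the monic irreducible factors (in $\mathbb{Z}[x]$) of $F_n(x)$ which are not factors of $F_k(x)$ for any $k<n$; $\Psi_1(x)=1$.
   Formalization: For p = 2, k = 1 the exponent φ(2)/2 = 1/2 is not an integer, so the congruence is stated when φ(p^k) is even (every other case), and in all cases in squared form: Ψ_{p^k}(x)² ≡ (x²+4)^{φ(p^k)} (mod p). -}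

module Defs where

open import Data.Nat as ℕ using (ℕ; zero; suc; _<_; _≤_)
open import Data.Nat.Coprimality using (coprime?)
open import Data.Integer as ℤ using (ℤ; +_; _-_)
open import Data.Integer.Divisibility as ℤD using ()
open import Data.List using (List; []; _∷_; filter; length; map; upTo)
open import Data.Product using (Σ; _×_)
open import Data.Sum using (_⊎_)
open import Relation.Nullary using (¬_)
open import Relation.Binary.PropositionalEquality using (_≡_)
open import Function.Bundles using (_⇔_)

φ : ℕ → ℕ
φ n = length (filter (λ m → coprime? m n) (map suc (upTo n)))

-- Polynomials in ℤ[x] as coefficient lists, lowest degree first
-- (trailing zeros allowed; equality is coefficientwise).
Poly : Set
Poly = List ℤ

coeff : Poly → ℕ → ℤ
coeff []       _       = + 0
coeff (a ∷ as) zero    = a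
coeff (a ∷ as) (suc i) = coeff as i

_≈ₚ_ : Poly → Poly → Set
f ≈ₚ g = ∀ i → coeff f i ≡ coeff g i

infixl 6 _+ₚ_
infixl 7 _*ₚ_

_+ₚ_ : Poly → Poly → Poly
[]       +ₚ g        = g
(a ∷ f)  +ₚ []       = a ∷ f
(a ∷ f)  +ₚ (b ∷ g)  = (a ℤ.+ b) ∷ (f +ₚ g)

scale : ℤ → Poly → Poly
scale c = map (c ℤ.*_)

_*ₚ_ : Poly → Poly → Poly
[]      *ₚ g = []
(a ∷ f) *ₚ g = scale a g +ₚ (+ 0 ∷ (f *ₚ g))

oneₚ : Poly
oneₚ = + 1 ∷ []

X : Poly
X = + 0 ∷ + 1 ∷ []

_^ₚ_ : Poly → ℕ → Poly
f ^ₚ zero    = oneₚ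
f ^ₚ suc n   = f *ₚ (f ^ₚ n)

F : ℕ → Poly
F zero          = []
F (suc zero)    = oneₚ
F (suc (suc n)) = (X *ₚ F (suc n)) +ₚ F n

_∣ₚ_ : Poly → Poly → Set
f ∣ₚ g = Σ Poly (λ h → (f *ₚ h) ≈ₚ g)

IsUnit : Poly → Set
IsUnit f = Σ Poly (λ g → (f *ₚ g) ≈ₚ oneₚ)

Irreducible : Poly → Set
Irreducible q = (¬ (q ≈ₚ [])) × (¬ IsUnit q)
              × (∀ a b → (a *ₚ b) ≈ₚ q → IsUnit a ⊎ IsUnit b)

Monic : Poly → Set
Monic f = Σ ℕ (λ d → (coeff f d ≡ + 1) × (∀ i → d < i → coeff f i ≡ + 0))

-- Ψ is the n-th fibotomic polynomial (n ≥ 2): the product of the (distinct)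
-- monic irreducible factors of F n that divide no F k with 1 ≤ k < n.
-- Characterised as: Ψ monic, squarefree, and its monic irreducible divisors
-- are exactly those factors (this determines Ψ uniquely, ℤ[x] being a UFD).
IsFibotomic : ℕ → Poly → Set
IsFibotomic n Ψ =
  Monic Ψ
  × (∀ q → Irreducible q → ¬ ((q *ₚ q) ∣ₚ Ψ))
  × (∀ q → Monic q → Irreducible q →
       (q ∣ₚ Ψ) ⇔ ((q ∣ₚ F n) × (∀ k → 1 ≤ k → k < n → ¬ (q ∣ₚ F k))))

ModEq : ℕ → Poly → Poly → Set
ModEq p f g = ∀ i → (+ p) ℤD.∣ (coeff f i - coeff g i)

{-# OPTIONS --safe #-}

-- Let n = p^(k+1) and m = p^k. Over ℤ[x] the F satisfy gcd (F_i , F_j) = F_(gcd i j),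
-- and (x² + 4) F_n′ = n L_n − x F_n makes F_n squarefree; by unique factorisation
-- (Gauss's lemma) Ψ_n is therefore the exact quotient F_n / F_m. Modulo p, adjoin a root α of
-- α² = x α + 1 with conjugate β and put δ = α − β, so δ² = x² + 4 and α^n − β^n = F_n δ. Frobenius
-- gives δ^n ≡ F_n δ, that is F_n² (x² + 4) ≡ (x² + 4)^n, and likewise for m; dividing,
-- Ψ_n² ≡ (x² + 4)^(n − m) with n − m = φ(n). When φ(n) is even both sides are squares of
-- monic polynomials, which over a field agree up to sign, and monicity fixes the sign.
module Submission where

open import Defs
open import Data.Nat using (ℕ; _^_; _/_; _≤_)
open import Data.Nat.Divisibility using (_∣_)
open import Data.Nat.Primality using (Prime)
open import Data.Integer using (+_)
open import Data.List using (_∷_; [])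
open import Data.Product using (_×_)

open import Algebra.Bundles using (CommutativeRing; CommutativeSemiring)
open import Data.Fin using (Fin; zero; suc)
open import Data.Fin.Properties using (toℕ-inject₁; toℕ-fromℕ; toℕ<n)
open import Data.Integer as ℤ using (ℤ; -[1+_])
import Data.Integer.Divisibility.Signed as ℤS
import Data.Integer.Properties as ℤP
open import Data.Integer.Tactic.RingSolver using () renaming (solve-∀ to solveℤ)
open import Data.List using (_++_; _∷ʳ_; length; filter; map; upTo)
open import Data.List.Properties using (upTo-∷ʳ; map-++; filter-++; length-++; filter-accept; filter-reject)
open import Data.List.Relation.Unary.All using (All; []; _∷_)
open import Data.Maybe using (Maybe; just; nothing)
open import Data.Nat as ℕ using (zero; suc; z≤n; s≤s; _<_; _!)
open import Data.Nat.Combinatorics using (nCn≡1; nCk≡n!/k![n-k]!; k![n∸k]!∣n!) renaming (_C_ to _choose_)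
open import Data.Nat.Coprimality using (Coprime; coprime?)
import Data.Nat.Divisibility as ℕD
open import Data.Nat.DivMod using (m/n*n≡m)
open import Data.Nat.GCD using (gcd; gcd-GCD; module Bézout; gcd[m,n]∣m; gcd[m,n]∣n)
open import Data.Nat.ListAction using (product)
open import Data.Nat.Primality using (euclidsLemma; prime⇒nonZero; prime⇒nonTrivial; ¬prime[0])
open import Data.Nat.Primality.Factorisation using (PrimeFactorisation; factorise)
import Data.Nat.Properties as ℕP
open import Data.Product using (Σ; Σ-syntax; ∃; ∃₂; _,_; proj₁; proj₂)
open import Data.Sum using (_⊎_; inj₁; inj₂; [_,_]′; map₁; map₂)
open import Function using (Equivalence; _∘_; id)
open import Level using (0ℓ)
open import Relation.Binary.Bundles using (Setoid)
open import Relation.Binary.Definitions using (tri<; tri≈; tri>)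
open import Relation.Binary.PropositionalEquality as ≡ using (_≡_; _≢_)
open import Relation.Nullary using (¬_; yes; no; contradiction)
open import Relation.Nullary.Decidable using (decidable-stable)
open import Relation.Unary using (Pred; Decidable)
open import Tactic.RingSolver using (solve-∀)
open import Tactic.RingSolver.Core.AlmostCommutativeRing using (AlmostCommutativeRing; fromCommutativeRing)

-- The Frobenius endomorphism

-- Polynomials over ℤ_p are not constructed: a congruence modulo p is divisibility by the constant
-- `C (+ p)` in ℤ[x]. Cancellation rests on `C-prime`, that p stays prime in ℤ[x], and on the fact
-- that p divides no monic polynomial. The same `C-prime` drives Gauss's lemma. ℤ[x] has no division
-- with remainder, so irreducible elements are shown to be prime by pseudo-division, whose integer
-- multipliers Gauss's lemma strips off again. Irreducible factors are found only up to double
-- negation; this suffices because what is extracted in the end is an equality of integer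
-- coefficients, which is decidable. The exponent φ(p^k)/2 is an integer unless p^k = 2, hence the
-- parity hypothesis in the first half of the theorem; the squared congruence covers every case. For
-- p = 2 the two signs of the square root coincide, so that prime runs through the same argument.

prime-∤-! : ∀ {p} → Prime p → ∀ {k} → k < p → ¬ p ∣ k !
prime-∤-! pp {zero} _ p∣1 = contradiction (ℕD.∣1⇒≡1 p∣1) (ℕ.nonTrivial⇒≢1 {{prime⇒nonTrivial pp}})
prime-∤-! pp {suc k} k<p p∣ = [ ℕD.>⇒∤ k<p , prime-∤-! pp (ℕP.<-trans (ℕP.n<1+n k) k<p) ]′
  (euclidsLemma (suc k) (k !) pp p∣)

-- The prime divides p! = (p choose k) · (k! (p - k)!) but neither factorial on the right.
prime-∣-C : ∀ {p} → Prime p → ∀ {k} → 0 < k → k < p → p ∣ p choose k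
prime-∣-C {p@(suc p-1)} pp {k@(suc k-1)} 0<k k<p =
  [ id , (λ p∣ → contradiction (euclidsLemma (k !) ((p ℕ.∸ k) !) pp p∣)
    [ prime-∤-! pp k<p , prime-∤-! pp (s≤s (ℕP.m∸n≤m p-1 k-1)) ]′) ]′
  (euclidsLemma (p choose k) (k ! ℕ.* (p ℕ.∸ k) !) pp (≡.subst (p ℕD.∣_) p!≡ (ℕD.divides (p-1 !) (ℕP.*-comm p (p-1 !)))))
  where
  instance _ = ℕP.m*n≢0 (k !) ((p ℕ.∸ k) !) {{ℕP._!≢0 k}} {{ℕP._!≢0 (p ℕ.∸ k)}}
  p!≡ : p ! ≡ (p choose k) ℕ.* (k ! ℕ.* (p ℕ.∸ k) !)
  p!≡ = ≡.sym (≡.trans (≡.cong (ℕ._* (k ! ℕ.* (p ℕ.∸ k) !)) (nCk≡n!/k![n-k]! (ℕP.<⇒≤ k<p)))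
    (m/n*n≡m (k![n∸k]!∣n! (ℕP.<⇒≤ k<p))))

module Frobenius {c ℓ} (R : CommutativeSemiring c ℓ) where
  open CommutativeSemiring R hiding (zero)
  open import Algebra.Properties.Semiring.Exp semiring using (^-congˡ; ^-assocʳ) renaming (_^_ to _↑_)
  open import Algebra.Properties.Semiring.Mult semiring renaming (_×_ to _·_)
  open import Algebra.Properties.Semiring.Sum semiring using (sum; sum-init-last; sum-cong-≋; sum-replicate-zero)
  open import Algebra.Properties.CommutativeSemiring.Binomial R using (theorem; binomialTerm)
  open import Data.Vec.Functional using (tail; init; last)
  open import Relation.Binary.Reasoning.Setoid setoid

  private
    ·-zeroʳ : ∀ n → n · 0# ≈ 0#
    ·-zeroʳ zero = refl
    ·-zeroʳ (suc n) = trans (+-identityˡ (n · 0#)) (·-zeroʳ n)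

  ∣⇒·≈0 : ∀ {p n} → p · 1# ≈ 0# → ∀ x → p ∣ n → n · x ≈ 0#
  ∣⇒·≈0 {p} p·1≈0 x (ℕD.divides q ≡.refl) = begin
    (q ℕ.* p) · x          ≈⟨ ×-assocˡ x q p ⟨
    q · (p · x)            ≈⟨ ×-congʳ q (×-congʳ p (*-identityˡ x)) ⟨
    q · (p · (1# * x))     ≈⟨ ×-congʳ q (×-assoc-* p 1# x) ⟨
    q · ((p · 1#) * x)     ≈⟨ ×-congʳ q (trans (*-congʳ p·1≈0) (zeroˡ x)) ⟩
    q · 0#                 ≈⟨ ·-zeroʳ q ⟩
    0#                     ∎

  -- The binomial sum is cut into its two end terms and the interior, whose coefficients are
  -- multiples of p and so act as zero.
  frobenius : ∀ {p} → Prime p → p · 1# ≈ 0# → ∀ x y → (x + y) ↑ p ≈ x ↑ p + y ↑ p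
  frobenius {zero} pp = contradiction pp ¬prime[0]
  frobenius {p@(suc p-1)} pp p·1≈0 x y = begin
    (x + y) ↑ p                                           ≈⟨ theorem p x y ⟩
    t zero + sum (tail t)                                 ≈⟨ +-cong first (sum-init-last (tail t)) ⟩
    y ↑ p + (sum (init (tail t)) + last (tail t))         ≈⟨ +-congˡ (+-cong middle final) ⟩
    y ↑ p + (0# + x ↑ p)                                  ≈⟨ +-congˡ (+-identityˡ (x ↑ p)) ⟩
    y ↑ p + x ↑ p                                         ≈⟨ +-comm (y ↑ p) (x ↑ p) ⟩
    x ↑ p + y ↑ p                                         ∎
    where
    t : Fin (suc p) → Carrier
    t = binomialTerm x y p
    first : t zero ≈ y ↑ p
    first = trans (×-homo-1 _) (*-identityˡ (y ↑ p))
    middle : sum (init (tail t)) ≈ 0#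
    middle = trans (sum-cong-≋ λ i → ∣⇒·≈0 p·1≈0 _ (prime-∣-C pp (s≤s z≤n)
        (s≤s (≡.subst (_< p-1) (≡.sym (toℕ-inject₁ i)) (toℕ<n i)))))
      (sum-replicate-zero p-1)
    final : last (tail t) ≈ x ↑ p
    final rewrite toℕ-fromℕ p-1 | nCn≡1 p | ℕP.n∸n≡0 p-1 = trans (×-homo-1 _) (*-identityʳ (x ↑ p))

  frobenius-^ : ∀ {p} → Prime p → p · 1# ≈ 0# → ∀ k x y →
    (x + y) ↑ (p ℕ.^ k) ≈ x ↑ (p ℕ.^ k) + y ↑ (p ℕ.^ k)
  frobenius-^ pp p·1≈0 zero x y = trans (*-identityʳ (x + y)) (+-cong (sym (*-identityʳ x)) (sym (*-identityʳ y)))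
  frobenius-^ {p} pp p·1≈0 (suc k) x y = begin
    (x + y) ↑ (p ℕ.* q)             ≈⟨ ^-assocʳ (x + y) p q ⟨
    ((x + y) ↑ p) ↑ q               ≈⟨ ^-congˡ q (frobenius pp p·1≈0 x y) ⟩
    (x ↑ p + y ↑ p) ↑ q             ≈⟨ frobenius-^ pp p·1≈0 k (x ↑ p) (y ↑ p) ⟩
    (x ↑ p) ↑ q + (y ↑ p) ↑ q       ≈⟨ +-cong (^-assocʳ x p q) (^-assocʳ y p q) ⟩
    x ↑ (p ℕ.* q) + y ↑ (p ℕ.* q)   ∎
    where
    q : ℕ
    q = p ℕ.^ k

-- The ring ℤ[x]

-- A record, since the unfolded _≈ₚ_ does not let Agda infer the two polynomials.
infix 4 _≋_
record _≋_ (f g : Poly) : Set where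
  constructor mk
  field at : f ≈ₚ g
open _≋_ public

infix 8 -ₚ_
-ₚ_ : Poly → Poly
-ₚ_ = scale (ℤ.- + 1)

C : ℤ → Poly
C c = c ∷ []

polySetoid : Setoid 0ℓ 0ℓ
polySetoid = record
  { Carrier = Poly
  ; _≈_ = _≋_
  ; isEquivalence = record
    { refl = mk λ _ → ≡.refl
    ; sym = λ e → mk λ i → ≡.sym (at e i)
    ; trans = λ e e′ → mk λ i → ≡.trans (at e i) (at e′ i)
    }
  }

open Setoid polySetoid using (refl; sym; trans)

private
  module ≋-Reasoning where
    open import Relation.Binary.Reasoning.Setoid polySetoid public

coeff-+ : ∀ f g i → coeff (f +ₚ g) i ≡ coeff f i ℤ.+ coeff g i
coeff-+ []      g       i       = ≡.sym (ℤP.+-identityˡ _)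
coeff-+ (a ∷ f) []      i       = ≡.sym (ℤP.+-identityʳ _)
coeff-+ (a ∷ f) (b ∷ g) zero    = ≡.refl
coeff-+ (a ∷ f) (b ∷ g) (suc i) = coeff-+ f g i

coeff-scale : ∀ c f i → coeff (scale c f) i ≡ c ℤ.* coeff f i
coeff-scale c []      i       = ≡.sym (ℤP.*-zeroʳ c)
coeff-scale c (a ∷ f) zero    = ≡.refl
coeff-scale c (a ∷ f) (suc i) = coeff-scale c f i

∷-cong : ∀ {a b f g} → a ≡ b → f ≋ g → a ∷ f ≋ b ∷ g
∷-cong a≡b f≋g = mk λ { zero → a≡b ; (suc i) → at f≋g i }

0∷[]≋[] : + 0 ∷ [] ≋ []
0∷[]≋[] = mk λ { zero → ≡.refl ; (suc _) → ≡.refl }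

+-cong : ∀ {f f′ g g′} → f ≋ f′ → g ≋ g′ → f +ₚ g ≋ f′ +ₚ g′
+-cong {f} {f′} {g} {g′} e e′ = mk λ i → ≡.trans (coeff-+ f g i)
  (≡.trans (≡.cong₂ ℤ._+_ (at e i) (at e′ i)) (≡.sym (coeff-+ f′ g′ i)))

+-congˡ : ∀ {f g g′} → g ≋ g′ → f +ₚ g ≋ f +ₚ g′
+-congˡ {f} = +-cong {f} refl

+-congʳ : ∀ {f f′ g} → f ≋ f′ → f +ₚ g ≋ f′ +ₚ g
+-congʳ e = +-cong e refl

scale-cong : ∀ c {f g} → f ≋ g → scale c f ≋ scale c g
scale-cong c {f} {g} e = mk λ i → ≡.trans (coeff-scale c f i)
  (≡.trans (≡.cong (c ℤ.*_) (at e i)) (≡.sym (coeff-scale c g i)))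

+-assoc : ∀ f g h → (f +ₚ g) +ₚ h ≋ f +ₚ (g +ₚ h)
+-assoc f g h = mk eq
  where
  eq : ((f +ₚ g) +ₚ h) ≈ₚ (f +ₚ (g +ₚ h))
  eq i rewrite coeff-+ (f +ₚ g) h i | coeff-+ f g i | coeff-+ f (g +ₚ h) i | coeff-+ g h i
    = ℤP.+-assoc (coeff f i) _ _

+-comm : ∀ f g → f +ₚ g ≋ g +ₚ f
+-comm f g = mk eq
  where
  eq : (f +ₚ g) ≈ₚ (g +ₚ f)
  eq i rewrite coeff-+ f g i | coeff-+ g f i = ℤP.+-comm (coeff f i) _

+-identityʳ : ∀ f → f +ₚ [] ≋ f
+-identityʳ f = +-comm f []

+-interchange : ∀ f g h k → (f +ₚ g) +ₚ (h +ₚ k) ≋ (f +ₚ h) +ₚ (g +ₚ k)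
+-interchange f g h k = mk eq
  where
  inter : ∀ a b c d → (a ℤ.+ b) ℤ.+ (c ℤ.+ d) ≡ (a ℤ.+ c) ℤ.+ (b ℤ.+ d)
  inter = solveℤ
  eq : ((f +ₚ g) +ₚ (h +ₚ k)) ≈ₚ ((f +ₚ h) +ₚ (g +ₚ k))
  eq i rewrite coeff-+ (f +ₚ g) (h +ₚ k) i | coeff-+ f g i | coeff-+ h k i
    | coeff-+ (f +ₚ h) (g +ₚ k) i | coeff-+ f h i | coeff-+ g k i
    = inter (coeff f i) _ _ _

scale-+ : ∀ c f g → scale c (f +ₚ g) ≋ scale c f +ₚ scale c g
scale-+ c f g = mk eq
  where
  eq : (scale c (f +ₚ g)) ≈ₚ (scale c f +ₚ scale c g)
  eq i rewrite coeff-scale c (f +ₚ g) i | coeff-+ f g i | coeff-+ (scale c f) (scale c g) i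
    | coeff-scale c f i | coeff-scale c g i = ℤP.*-distribˡ-+ c _ _

scale-scale : ∀ a b f → scale (a ℤ.* b) f ≋ scale a (scale b f)
scale-scale a b f = mk eq
  where
  eq : (scale (a ℤ.* b) f) ≈ₚ (scale a (scale b f))
  eq i rewrite coeff-scale (a ℤ.* b) f i | coeff-scale a (scale b f) i | coeff-scale b f i
    = ℤP.*-assoc a b _

scale-0 : ∀ f → scale (+ 0) f ≋ []
scale-0 f = mk (coeff-scale (+ 0) f)

scale-1 : ∀ f → scale (+ 1) f ≋ f
scale-1 f = mk λ i → ≡.trans (coeff-scale (+ 1) f i) (ℤP.*-identityˡ _)

scale-shift : ∀ c f → scale c (+ 0 ∷ f) ≋ + 0 ∷ scale c f
scale-shift c f = ∷-cong (ℤP.*-zeroʳ c) refl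

-ₚ-inverseʳ : ∀ f → f +ₚ -ₚ f ≋ []
-ₚ-inverseʳ f = mk eq
  where
  cancel : ∀ a → a ℤ.+ (ℤ.- + 1) ℤ.* a ≡ + 0
  cancel = solveℤ
  eq : (f +ₚ -ₚ f) ≈ₚ ([])
  eq i rewrite coeff-+ f (-ₚ f) i | coeff-scale (ℤ.- + 1) f i = cancel (coeff f i)

*-zeroʳ : ∀ f → f *ₚ [] ≋ []
*-zeroʳ []      = refl
*-zeroʳ (a ∷ f) = trans (∷-cong ≡.refl (*-zeroʳ f)) 0∷[]≋[]

*-congˡ : ∀ f {g g′} → g ≋ g′ → f *ₚ g ≋ f *ₚ g′
*-congˡ []      e = refl
*-congˡ (a ∷ f) e = +-cong (scale-cong a e) (∷-cong ≡.refl (*-congˡ f e))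

-- The mirror image of the defining clause of `_*ₚ_`, which recurses on the left factor only;
-- commutativity follows from the pair.
*-∷ : ∀ f b g → f *ₚ (b ∷ g) ≋ scale b f +ₚ (+ 0 ∷ (f *ₚ g))
*-∷ []      b g = sym 0∷[]≋[]
*-∷ (a ∷ f) b g = ∷-cong (≡.cong (ℤ._+ + 0) (ℤP.*-comm a b)) (begin
  scale a g +ₚ f *ₚ (b ∷ g)                    ≈⟨ +-congˡ {scale a g} (*-∷ f b g) ⟩
  scale a g +ₚ (scale b f +ₚ (+ 0 ∷ f *ₚ g))   ≈⟨ +-assoc (scale a g) _ _ ⟨
  (scale a g +ₚ scale b f) +ₚ (+ 0 ∷ f *ₚ g)   ≈⟨ +-congʳ (+-comm (scale a g) _) ⟩
  (scale b f +ₚ scale a g) +ₚ (+ 0 ∷ f *ₚ g)   ≈⟨ +-assoc (scale b f) _ _ ⟩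
  scale b f +ₚ (scale a g +ₚ (+ 0 ∷ f *ₚ g))   ∎)
  where open ≋-Reasoning

*-comm : ∀ f g → f *ₚ g ≋ g *ₚ f
*-comm []      g = sym (*-zeroʳ g)
*-comm (a ∷ f) g = trans
  (+-congˡ {scale a g} (∷-cong ≡.refl (*-comm f g))) (sym (*-∷ g a f))

*-cong : ∀ {f f′ g g′} → f ≋ f′ → g ≋ g′ → f *ₚ g ≋ f′ *ₚ g′
*-cong {f} {f′} {g} {g′} e e′ = begin
  f *ₚ g    ≈⟨ *-congˡ f e′ ⟩
  f *ₚ g′   ≈⟨ *-comm f g′ ⟩
  g′ *ₚ f   ≈⟨ *-congˡ g′ e ⟩
  g′ *ₚ f′  ≈⟨ *-comm g′ f′ ⟩
  f′ *ₚ g′  ∎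
  where open ≋-Reasoning

*-distribˡ : ∀ f g h → f *ₚ (g +ₚ h) ≋ f *ₚ g +ₚ f *ₚ h
*-distribˡ []      g h = refl
*-distribˡ (a ∷ f) g h = begin
  scale a (g +ₚ h) +ₚ (+ 0 ∷ f *ₚ (g +ₚ h))
    ≈⟨ +-cong (scale-+ a g h) (∷-cong ≡.refl (*-distribˡ f g h)) ⟩
  (scale a g +ₚ scale a h) +ₚ ((+ 0 ∷ f *ₚ g) +ₚ (+ 0 ∷ f *ₚ h))
    ≈⟨ +-interchange (scale a g) (scale a h) _ _ ⟩
  (a ∷ f) *ₚ g +ₚ (a ∷ f) *ₚ h ∎
  where open ≋-Reasoning

*-distribʳ : ∀ f g h → (g +ₚ h) *ₚ f ≋ g *ₚ f +ₚ h *ₚ f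
*-distribʳ f g h = begin
  (g +ₚ h) *ₚ f        ≈⟨ *-comm (g +ₚ h) f ⟩
  f *ₚ (g +ₚ h)        ≈⟨ *-distribˡ f g h ⟩
  f *ₚ g +ₚ f *ₚ h     ≈⟨ +-cong (*-comm f g) (*-comm f h) ⟩
  g *ₚ f +ₚ h *ₚ f     ∎
  where open ≋-Reasoning

scale-* : ∀ c f g → scale c f *ₚ g ≋ scale c (f *ₚ g)
scale-* c []      g = refl
scale-* c (a ∷ f) g = begin
  scale (c ℤ.* a) g +ₚ (+ 0 ∷ scale c f *ₚ g)
    ≈⟨ +-cong (scale-scale c a g) (∷-cong ≡.refl (scale-* c f g)) ⟩
  scale c (scale a g) +ₚ (+ 0 ∷ scale c (f *ₚ g))
    ≈⟨ +-congˡ {scale c (scale a g)} (scale-shift c (f *ₚ g)) ⟨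
  scale c (scale a g) +ₚ scale c (+ 0 ∷ f *ₚ g)
    ≈⟨ scale-+ c (scale a g) _ ⟨
  scale c ((a ∷ f) *ₚ g) ∎
  where open ≋-Reasoning

shift-* : ∀ f g → (+ 0 ∷ f) *ₚ g ≋ + 0 ∷ f *ₚ g
shift-* f g = +-congʳ (scale-0 g)

*-assoc : ∀ f g h → (f *ₚ g) *ₚ h ≋ f *ₚ (g *ₚ h)
*-assoc []      g h = refl
*-assoc (a ∷ f) g h = begin
  (scale a g +ₚ (+ 0 ∷ f *ₚ g)) *ₚ h
    ≈⟨ *-distribʳ h (scale a g) _ ⟩
  scale a g *ₚ h +ₚ (+ 0 ∷ f *ₚ g) *ₚ h
    ≈⟨ +-cong (scale-* a g h) (shift-* (f *ₚ g) h) ⟩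
  scale a (g *ₚ h) +ₚ (+ 0 ∷ (f *ₚ g) *ₚ h)
    ≈⟨ +-congˡ {scale a (g *ₚ h)} (∷-cong ≡.refl (*-assoc f g h)) ⟩
  (a ∷ f) *ₚ (g *ₚ h) ∎
  where open ≋-Reasoning

C-* : ∀ c f → C c *ₚ f ≋ scale c f
C-* c f = trans (+-congˡ {scale c f} 0∷[]≋[]) (+-identityʳ (scale c f))

X-* : ∀ f → X *ₚ f ≋ + 0 ∷ f
X-* f = trans (shift-* oneₚ f)
  (∷-cong ≡.refl (trans (C-* (+ 1) f) (scale-1 f)))

*-identityˡ : ∀ f → oneₚ *ₚ f ≋ f
*-identityˡ f = trans (C-* (+ 1) f) (scale-1 f)

polyRing : CommutativeRing 0ℓ 0ℓ
polyRing = record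
  { Carrier = Poly
  ; _≈_ = _≋_
  ; _+_ = _+ₚ_
  ; _*_ = _*ₚ_
  ; -_ = -ₚ_
  ; 0# = []
  ; 1# = oneₚ
  ; isCommutativeRing = record
    { isRing = record
      { +-isAbelianGroup = record
        { isGroup = record
          { isMonoid = record
            { isSemigroup = record
              { isMagma = record
                { isEquivalence = Setoid.isEquivalence polySetoid
                ; ∙-cong = +-cong
                }
              ; assoc = +-assoc
              }
            ; identity = (λ _ → refl) , +-identityʳ
            }
          ; inverse = (λ f → trans (+-comm (-ₚ f) f) (-ₚ-inverseʳ f)) , -ₚ-inverseʳ
          ; ⁻¹-cong = scale-cong (ℤ.- + 1)
          }
        ; comm = +-comm
        }
      ; *-cong = *-cong
      ; *-assoc = *-assoc
      ; *-identity = *-identityˡ , (λ f → trans (*-comm f oneₚ) (*-identityˡ f))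
      ; distrib = *-distribˡ , *-distribʳ
      }
    ; *-comm = *-comm
    }
  }

-- The zero test by which the ring solver drops vanishing coefficients.
isZero? : ∀ f → Maybe ([] ≋ f)
isZero? []      = just refl
isZero? (a ∷ f) with a ℤ.≟ + 0 | isZero? f
... | yes a≡0 | just e = just (mk λ { zero → ≡.sym a≡0 ; (suc i) → at e i })
... | _       | _      = nothing

polyACR : AlmostCommutativeRing 0ℓ 0ℓ
polyACR = fromCommutativeRing polyRing isZero?

open import Algebra.Properties.Monoid.Divisibility (CommutativeRing.*-monoid polyRing) using (_,_; ∣ˡ-refl; ∣ˡ-trans; ∣ˡ-respʳ-≈; x∣ˡy⇒x∣ˡyz) renaming (_∣ˡ_ to _∣ᴾ_)

∣⇒∣ₚ : ∀ {f g} → f ∣ᴾ g → f ∣ₚ g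
∣⇒∣ₚ (h , e) = h , at e

∣ₚ⇒∣ : ∀ {f g} → f ∣ₚ g → f ∣ᴾ g
∣ₚ⇒∣ (h , e) = h , mk e

∣-* : ∀ {f g} h → f ∣ᴾ g → f ∣ᴾ h *ₚ g
∣-* {f} {g} h f∣g = ∣ˡ-respʳ-≈ (*-comm g h) (x∣ˡy⇒x∣ˡyz h f∣g)

∣-+ : ∀ {f g h} → f ∣ᴾ g → f ∣ᴾ h → f ∣ᴾ g +ₚ h
∣-+ {f} (q , e) (q′ , e′) = q +ₚ q′ , trans (*-distribˡ f q q′) (+-cong e e′)

∣-neg : ∀ {f g} → f ∣ᴾ g → f ∣ᴾ -ₚ g
∣-neg {f} (q , e) = -ₚ q , trans (eq f q) (scale-cong (ℤ.- + 1) e)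
  where
  eq : ∀ f q → f *ₚ -ₚ q ≋ -ₚ (f *ₚ q)
  eq = solve-∀ polyACR

∣-cancel-+ : ∀ {f g h k} → g +ₚ h ≋ k → f ∣ᴾ g → f ∣ᴾ k → f ∣ᴾ h
∣-cancel-+ {f} {g} {h} {k} e f∣g f∣k =
  ∣ˡ-respʳ-≈ (trans (+-congʳ (sym e)) (eq g h)) (∣-+ f∣k (∣-neg f∣g))
  where
  eq : ∀ g h → (g +ₚ h) +ₚ -ₚ g ≋ h
  eq = solve-∀ polyACR

∷-≋ : ∀ a f → a ∷ f ≋ C a +ₚ X *ₚ f
∷-≋ a f = trans (∷-cong (≡.sym (ℤP.+-identityʳ a)) refl) (+-congˡ {C a} (sym (X-* f)))

C-homo-* : ∀ a b → C (a ℤ.* b) ≋ C a *ₚ C b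
C-homo-* a b = sym (C-* a (C b))

C-zero : ∀ f → C (+ 0) *ₚ f ≋ []
C-zero f = trans (C-* (+ 0) f) (scale-0 f)

coeff-C* : ∀ c f i → coeff (C c *ₚ f) i ≡ c ℤ.* coeff f i
coeff-C* c f i = ≡.trans (at (C-* c f) i) (coeff-scale c f i)

C-cancel : ∀ {c f g} → c ≢ + 0 → C c *ₚ f ≋ C c *ₚ g → f ≋ g
C-cancel {c} {f} {g} c≢0 e = mk λ i → ℤP.*-cancelˡ-≡ c _ _ {{ℤ.≢-nonZero c≢0}}
  (≡.trans (≡.sym (coeff-C* c f i)) (≡.trans (at e i) (coeff-C* c g i)))

-- Degree and leading coefficient

Deg< : Poly → ℕ → Set
Deg< f n = ∀ i → n ≤ i → coeff f i ≡ + 0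

-- The coefficient `c` may be zero, so that products and scalings need no side conditions;
-- nonvanishing is a separate hypothesis wherever `d` must be the true degree.
record Leading (f : Poly) (d : ℕ) (c : ℤ) : Set where
  constructor _,_
  field
    top : coeff f d ≡ c
    above : Deg< f (suc d)

deg<0⇒≋[] : ∀ {f} → Deg< f 0 → f ≋ []
deg<0⇒≋[] f<0 = mk λ i → f<0 i z≤n

leading-resp-≋ : ∀ {f g d c} → f ≋ g → Leading f d c → Leading g d c
leading-resp-≋ e (top , above) = ≡.trans (≡.sym (at e _)) top ,
  λ i d<i → ≡.trans (≡.sym (at e i)) (above i d<i)

leading-scale : ∀ {g e b} a → Leading g e b → Leading (scale a g) e (a ℤ.* b)
leading-scale {g} {e} a (≡.refl , above) = coeff-scale a g e ,
  λ i e<i → ≡.trans (coeff-scale a g i) (≡.trans (≡.cong (a ℤ.*_) (above i e<i)) (ℤP.*-zeroʳ a))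

leading-* : ∀ f g {d e a b} → Leading f d a → Leading g e b → Leading (f *ₚ g) (d ℕ.+ e) (a ℤ.* b)
leading-* [] g (≡.refl , _) _ = ≡.refl , λ _ _ → ≡.refl
leading-* (x ∷ f) g {zero} (≡.refl , above) lead =
  leading-resp-≋ (sym eq) (leading-scale x lead)
  where
  eq : (x ∷ f) *ₚ g ≋ scale x g
  eq = trans (*-cong {x ∷ f} {C x} {g} (∷-cong ≡.refl (deg<0⇒≋[] {f} λ i _ → above (suc i) (s≤s z≤n))) refl) (C-* x g)
leading-* (x ∷ f) g {suc d} {e} {a} {b} (top , above) lead@(_ , above-g)
  with leading-* f g {d} {e} {a} {b} (top , λ i d<i → above (suc i) (s≤s d<i)) lead
... | top′ , above′ = sums (d ℕ.+ e) (ℕP.m≤n+m e d) top′ ,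
  λ { (suc i) (s≤s le) → sums i (ℕP.≤-trans (ℕP.m≤n+m e d) (ℕP.<⇒≤ le)) (above′ i le) }
  where
  sums : ∀ i {c} → e ≤ i → coeff (f *ₚ g) i ≡ c → coeff ((x ∷ f) *ₚ g) (suc i) ≡ c
  sums i {c} e≤i ih rewrite coeff-+ (scale x g) (+ 0 ∷ f *ₚ g) (suc i)
    | coeff-scale x g (suc i) | above-g (suc i) (s≤s e≤i) | ℤP.*-zeroʳ x | ih = ℤP.+-identityˡ c

leading-unique : ∀ {f d e a b} → a ≢ + 0 → b ≢ + 0 → Leading f d a → Leading f e b → d ≡ e × a ≡ b
leading-unique {f} {d} {e} a≢0 b≢0 (top , above) (top′ , above′) with ℕP.<-cmp d e
... | tri< d<e _ _ = contradiction (≡.trans (≡.sym top′) (above e d<e)) b≢0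
... | tri≈ _ ≡.refl _ = ≡.refl , ≡.trans (≡.sym top) top′
... | tri> _ _ e<d = contradiction (≡.trans (≡.sym top) (above′ d e<d)) a≢0

NonZeroLeading : Poly → Set
NonZeroLeading f = Σ ℕ λ d → Σ ℤ λ c → c ≢ + 0 × Leading f d c

leading? : ∀ f → f ≋ [] ⊎ NonZeroLeading f
leading? [] = inj₁ refl
leading? (a ∷ f) with leading? f
... | inj₂ (d , c , c≢0 , top , above) = inj₂ (suc d , c , c≢0 , top ,
  λ { (suc i) (s≤s d<i) → above i d<i })
... | inj₁ f≋[] with a ℤ.≟ + 0
...   | yes a≡0 = inj₁ (trans (∷-cong a≡0 f≋[]) 0∷[]≋[])
...   | no a≢0 = inj₂ (0 , a , a≢0 , ≡.refl , λ { (suc i) _ → at f≋[] i })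

leading-C : ∀ c → Leading (C c) 0 c
leading-C c = ≡.refl , λ { (suc i) _ → ≡.refl }

leading-0⇒C : ∀ {f c} → Leading f 0 c → f ≋ C c
leading-0⇒C (top , above) = mk λ { zero → top ; (suc i) → above (suc i) (s≤s z≤n) }

deg<-leading : ∀ {f n d c} → c ≢ + 0 → Deg< f n → Leading f d c → d < n
deg<-leading {f} {n} {d} c≢0 f<n (top , _) with d ℕP.<? n
... | yes d<n = d<n
... | no d≮n = contradiction (≡.trans (≡.sym top) (f<n d (ℕP.≮⇒≥ d≮n))) c≢0

*-≢0 : ∀ {a b} → a ≢ + 0 → b ≢ + 0 → a ℤ.* b ≢ + 0
*-≢0 {a} a≢0 b≢0 ab≡0 = [ a≢0 , b≢0 ]′ (ℤP.i*j≡0⇒i≡0∨j≡0 a ab≡0)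

leading-≢[] : ∀ {f d c} → c ≢ + 0 → Leading f d c → ¬ f ≋ []
leading-≢[] c≢0 (top , _) f≋[] = c≢0 (≡.trans (≡.sym top) (at f≋[] _))

record Factors (f g : Poly) (n : ℕ) (u : ℤ) : Set where
  field
    {d e} : ℕ
    {a b} : ℤ
    leadˡ : Leading f d a
    leadʳ : Leading g e b
    a≢0 : a ≢ + 0
    b≢0 : b ≢ + 0
    deg-+ : d ℕ.+ e ≡ n
    lead-* : a ℤ.* b ≡ u

leading-factors : ∀ f g {k n u} → u ≢ + 0 → f *ₚ g ≋ k → Leading k n u → Factors f g n u
leading-factors f g u≢0 eq lead with leading? f | leading? g
... | inj₁ f≋[] | _ = contradiction (trans (sym eq) (*-cong {f} {[]} {g} f≋[] refl)) (leading-≢[] u≢0 lead)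
... | inj₂ _ | inj₁ g≋[] = contradiction (trans (sym eq) (trans (*-congˡ f g≋[]) (*-zeroʳ f))) (leading-≢[] u≢0 lead)
... | inj₂ (d , a , a≢0 , l) | inj₂ (e , b , b≢0 , l′)
  with leading-unique (*-≢0 a≢0 b≢0) u≢0 (leading-resp-≋ eq (leading-* f g l l′)) lead
...   | deg , prod = record { leadˡ = l ; leadʳ = l′ ; a≢0 = a≢0 ; b≢0 = b≢0 ; deg-+ = deg ; lead-* = prod }

1≢0 : + 1 ≢ + 0
1≢0 ()

unit-leading : ∀ {f} → IsUnit f → ∃ λ c → c ≢ + 0 × Leading f 0 c
unit-leading {f} (g , e) = a , a≢0 ,
  ≡.subst (λ n → Leading f n a) (ℕP.m+n≡0⇒m≡0 d deg-+) leadˡ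
  where open Factors (leading-factors f g {oneₚ} 1≢0 (mk e) (leading-C (+ 1)))

-- Division with remainder in ℚ[x] after clearing the denominator `s`. The bound `Deg< r e` admits a
-- zero remainder.
PseudoDivision : Poly → ℕ → Poly → Set
PseudoDivision a e q = ∃ λ s → s ≢ + 0 × Σ Poly λ h → Σ Poly λ r → C s *ₚ q ≋ a *ₚ h +ₚ r × Deg< r e

-- Multiplying by a power of the leading coefficient of a
-- makes long division by a possible over ℤ.
pseudo-division : ∀ {a e ℓ} → ℓ ≢ + 0 → Leading a e ℓ → ∀ q → PseudoDivision a e q
pseudo-division {a} ℓ≢0 lead [] = + 1 , 1≢0 , [] , [] ,
  sym (trans (+-identityʳ _) (trans (*-zeroʳ a) (sym (*-zeroʳ (C (+ 1)))))) , λ _ _ → ≡.refl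
pseudo-division {a} {e} {ℓ} ℓ≢0 lead@(top , above) (b ∷ q) with pseudo-division ℓ≢0 lead q
... | s , s≢0 , h , r , eq , r<e = ℓ ℤ.* s , *-≢0 ℓ≢0 s≢0 , C ℓ *ₚ (X *ₚ h) +ₚ C c , r″ , eq″ , r″<e
  where
  -- Prefixing a coefficient to `q` gives the remainder candidate s b + x r, of degree at most `e`.
  -- Multiplying it by `ℓ` and subtracting `c` times `a` kills its coefficient at `e`.
  r′ : Poly
  r′ = s ℤ.* b ∷ r
  c : ℤ
  c = coeff r′ e
  r″ : Poly
  r″ = C ℓ *ₚ r′ +ₚ -ₚ (C c *ₚ a)

  value : ℤ → ℤ → ℤ
  value x y = ℓ ℤ.* x ℤ.+ (ℤ.- + 1) ℤ.* (c ℤ.* y)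

  coeff-r″ : ∀ i → coeff r″ i ≡ value (coeff r′ i) (coeff a i)
  coeff-r″ i rewrite coeff-+ (C ℓ *ₚ r′) (-ₚ (C c *ₚ a)) i | coeff-C* ℓ r′ i
    | coeff-scale (ℤ.- + 1) (C c *ₚ a) i | coeff-C* c a i = ≡.refl

  r′≤e : ∀ i → e < i → coeff r′ i ≡ + 0
  r′≤e (suc i) (s≤s e≤i) = r<e i e≤i

  zero-at-e : ∀ l c → l ℤ.* c ℤ.+ (ℤ.- + 1) ℤ.* (c ℤ.* l) ≡ + 0
  zero-at-e = solveℤ

  zero-above : ∀ l c → l ℤ.* + 0 ℤ.+ (ℤ.- + 1) ℤ.* (c ℤ.* + 0) ≡ + 0
  zero-above = solveℤ

  r″<e : Deg< r″ e
  r″<e i e≤i with ℕP.m≤n⇒m<n∨m≡n e≤i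
  ... | inj₁ e<i = ≡.trans (coeff-r″ i) (≡.trans (≡.cong₂ value (r′≤e i e<i) (above i e<i)) (zero-above ℓ c))
  ... | inj₂ ≡.refl = ≡.trans (coeff-r″ e) (≡.trans (≡.cong (value c) top) (zero-at-e ℓ c))

  expand : ∀ l s b x q → (l *ₚ s) *ₚ (b +ₚ x *ₚ q) ≋ l *ₚ (s *ₚ b +ₚ x *ₚ (s *ₚ q))
  expand = solve-∀ polyACR

  collect : ∀ l s b x a h r c → l *ₚ (s *ₚ b +ₚ x *ₚ (a *ₚ h +ₚ r))
    ≋ a *ₚ (l *ₚ (x *ₚ h) +ₚ c) +ₚ (l *ₚ (s *ₚ b +ₚ x *ₚ r) +ₚ -ₚ (c *ₚ a))
  collect = solve-∀ polyACR

  eq″ : C (ℓ ℤ.* s) *ₚ (b ∷ q) ≋ a *ₚ (C ℓ *ₚ (X *ₚ h) +ₚ C c) +ₚ r″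
  eq″ = begin
    C (ℓ ℤ.* s) *ₚ (b ∷ q)
      ≈⟨ *-cong (C-homo-* ℓ s) (∷-≋ b q) ⟩
    (C ℓ *ₚ C s) *ₚ (C b +ₚ X *ₚ q)
      ≈⟨ expand (C ℓ) (C s) (C b) X q ⟩
    C ℓ *ₚ (C s *ₚ C b +ₚ X *ₚ (C s *ₚ q))
      ≈⟨ *-congˡ (C ℓ) (+-congˡ {C s *ₚ C b} (*-congˡ X eq)) ⟩
    C ℓ *ₚ (C s *ₚ C b +ₚ X *ₚ (a *ₚ h +ₚ r))
      ≈⟨ collect (C ℓ) (C s) (C b) X a h r (C c) ⟩
    a *ₚ (C ℓ *ₚ (X *ₚ h) +ₚ C c) +ₚ (C ℓ *ₚ (C s *ₚ C b +ₚ X *ₚ r) +ₚ -ₚ (C c *ₚ a))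
      ≈⟨ +-congˡ {a *ₚ (C ℓ *ₚ (X *ₚ h) +ₚ C c)} (+-congʳ {g = -ₚ (C c *ₚ a)}
           (*-congˡ (C ℓ) {C s *ₚ C b +ₚ X *ₚ r} {r′} (trans (+-congʳ {g = X *ₚ r} (sym (C-homo-* s b))) (sym (∷-≋ (s ℤ.* b) r))))) ⟩
    a *ₚ (C ℓ *ₚ (X *ₚ h) +ₚ C c) +ₚ r″ ∎
    where open ≋-Reasoning

-- Gauss's lemma

∣-coeff : ∀ {c f} → C c ∣ᴾ f → ∀ i → c ℤS.∣ coeff f i
∣-coeff {c} (h , e) i = ℤS.divides (coeff h i)
  (≡.trans (≡.sym (at e i)) (≡.trans (coeff-C* c h i) (ℤP.*-comm c _)))

coeff-∣ : ∀ {c} f → (∀ i → c ℤS.∣ coeff f i) → C c ∣ᴾ f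
coeff-∣ {c} [] _ = [] , *-zeroʳ (C c)
coeff-∣ {c} (a ∷ f) div with div 0 | coeff-∣ f (div ∘ suc)
... | ℤS.divides q e | h , e′ = q ∷ h , trans (C-* c (q ∷ h))
  (∷-cong (≡.trans (ℤP.*-comm c q) (≡.sym e)) (trans (sym (C-* c h)) e′))

ℤ-euclidsLemma : ∀ {p} → Prime p → ∀ i j → + p ℤS.∣ i ℤ.* j → + p ℤS.∣ i ⊎ + p ℤS.∣ j
ℤ-euclidsLemma {p} pp i j d with euclidsLemma ℤ.∣ i ∣ ℤ.∣ j ∣ pp
    (≡.subst (p ℕD.∣_) (ℤP.abs-* i j) (ℤS.∣⇒∣ᵤ d))
... | inj₁ e = inj₁ (ℤS.∣ᵤ⇒∣ e)
... | inj₂ e = inj₂ (ℤS.∣ᵤ⇒∣ e)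

-- The constant term of the product shows that p divides `a` or `b`. That term can then be dropped
-- from its factor without losing divisibility of the remaining product, which is what the induction
-- runs on.
C-prime : ∀ {p} → Prime p → ∀ f g → C (+ p) ∣ᴾ f *ₚ g → C (+ p) ∣ᴾ f ⊎ C (+ p) ∣ᴾ g
C-prime pp [] g d = inj₁ (coeff-∣ [] λ _ → ℤS.divides (+ 0) ≡.refl)
C-prime pp (a ∷ f) [] d = inj₂ (coeff-∣ [] λ _ → ℤS.divides (+ 0) ≡.refl)
C-prime {p} pp (a ∷ f) (b ∷ g) d =
  [ (λ p∣a → map₁ (∣-∷ p∣a) (C-prime pp f (b ∷ g) (tail-∣ {a} {b ∷ g} refl p∣a)))
  , (λ p∣b → map₂ (∣-∷ p∣b) (C-prime pp (a ∷ f) g (tail-∣ {b} {a ∷ f} (*-∷ (a ∷ f) b g) p∣b)))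
  ]′ (ℤ-euclidsLemma pp a b (≡.subst (+ p ℤS.∣_) (ℤP.+-identityʳ (a ℤ.* b)) (∣-coeff d 0)))
  where
  tail-∣ : ∀ {c k h} → (a ∷ f) *ₚ (b ∷ g) ≋ scale c k +ₚ (+ 0 ∷ h) → + p ℤS.∣ c → C (+ p) ∣ᴾ h
  tail-∣ {c} {k} {h} e p∣c = coeff-∣ h λ i → ℤS.∣m+n∣m⇒∣n
    (≡.subst (+ p ℤS.∣_) (≡.trans (at e (suc i)) (coeff-+ (scale c k) (+ 0 ∷ h) (suc i))) (∣-coeff d (suc i)))
    (≡.subst (+ p ℤS.∣_) (≡.sym (coeff-scale c k (suc i))) (ℤS.∣m⇒∣m*n _ p∣c))

  ∣-∷ : ∀ {c h} → + p ℤS.∣ c → C (+ p) ∣ᴾ h → C (+ p) ∣ᴾ (c ∷ h)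
  ∣-∷ p∣c p∣h = coeff-∣ _ λ { zero → p∣c ; (suc i) → ∣-coeff p∣h i }

-- The form of Gauss's lemma used throughout: a factorisation of an integer multiple of `q` becomes
-- one of `q` itself once the integer is distributed over the two factors. Contents as gcds of
-- coefficients are thereby avoided.
record ContentSplit (m : ℕ) (q g h : Poly) : Set where
  field
    m₁ m₂ : ℕ
    g′ h′ : Poly
    m-≡ : m ≡ m₁ ℕ.* m₂
    g-≋ : g ≋ C (+ m₁) *ₚ g′
    h-≋ : h ≋ C (+ m₂) *ₚ h′
    q-≋ : q ≋ g′ *ₚ h′

+≢0 : ∀ {m} .{{_ : ℕ.NonZero m}} → + m ≢ + 0
+≢0 {suc m} ()

-- The primes are treated one at a time: by `C-prime` each divides `g` or `h`, is cancelled there,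
-- and is charged to `m₁` or `m₂`.
split-product : ∀ {ps} → All Prime ps → ∀ q g h → C (+ product ps) *ₚ q ≋ g *ₚ h →
  ContentSplit (product ps) q g h
split-product [] q g h e = record
  { m₁ = 1 ; m₂ = 1 ; g′ = g ; h′ = h ; m-≡ = ≡.refl
  ; g-≋ = sym (*-identityˡ g) ; h-≋ = sym (*-identityˡ h)
  ; q-≋ = trans (sym (*-identityˡ q)) e }
split-product {p ∷ ps} (pp ∷ pps) q g h e = go (C-prime pp g h (C (+ product ps) *ₚ q , e′))
  where
  instance _ = prime⇒nonZero pp
  P = C (+ p)
  e′ : P *ₚ (C (+ product ps) *ₚ q) ≋ g *ₚ h
  e′ = trans (sym (*-assoc P (C (+ product ps)) q)) (trans (*-cong {g = q}
    (trans (sym (C-homo-* (+ p) (+ product ps))) (∷-cong (≡.sym (ℤP.pos-* p (product ps))) refl)) refl) e)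

  swap : ∀ x a b → x *ₚ a *ₚ b ≋ x *ₚ (a *ₚ b)
  swap = solve-∀ polyACR
  swap′ : ∀ x a b → a *ₚ (x *ₚ b) ≋ x *ₚ (a *ₚ b)
  swap′ = solve-∀ polyACR

  C-split : ∀ m f f′ → f ≋ C (+ m) *ₚ f′ → P *ₚ f ≋ C (+ (p ℕ.* m)) *ₚ f′
  C-split m f f′ e = trans (*-congˡ P e) (trans (sym (*-assoc P (C (+ m)) f′))
    (*-cong {g = f′} (trans (sym (C-homo-* (+ p) (+ m))) (∷-cong (≡.sym (ℤP.pos-* p m)) refl)) refl))

  go : P ∣ᴾ g ⊎ P ∣ᴾ h → ContentSplit (p ℕ.* product ps) q g h
  go (inj₁ (k , Pk≋g)) = record
    { m₁ = p ℕ.* m₁ ; m₂ = m₂ ; g′ = g′ ; h′ = h′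
    ; m-≡ = ≡.trans (≡.cong (p ℕ.*_) m-≡) (≡.sym (ℕP.*-assoc p m₁ m₂))
    ; g-≋ = trans (sym Pk≋g) (C-split m₁ k g′ g-≋)
    ; h-≋ = h-≋ ; q-≋ = q-≋ }
    where open ContentSplit (split-product pps q k h (C-cancel {+ p} +≢0
            (trans e′ (trans (*-cong {g = h} (sym Pk≋g) refl) (swap P k h)))))
  go (inj₂ (k , Pk≋h)) = record
    { m₁ = m₁ ; m₂ = p ℕ.* m₂ ; g′ = g′ ; h′ = h′
    ; m-≡ = ≡.trans (≡.cong (p ℕ.*_) m-≡) (x∙yz≈y∙xz p m₁ m₂)
    ; g-≋ = g-≋
    ; h-≋ = trans (sym Pk≋h) (C-split m₂ k h′ h-≋)
    ; q-≋ = q-≋ }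
    where
    open import Algebra.Properties.CommutativeSemigroup ℕP.*-commutativeSemigroup using (x∙yz≈y∙xz)
    open ContentSplit (split-product pps q g k (C-cancel {+ p} +≢0
            (trans e′ (trans (*-congˡ g (sym Pk≋h)) (swap′ P g k)))))

content-split : ∀ m .{{_ : ℕ.NonZero m}} {q} g h → C (+ m) *ₚ q ≋ g *ₚ h → ContentSplit m q g h
content-split m {q} g h e = ≡.subst (λ n → ContentSplit n q g h) (≡.sym isFactorisation)
  (split-product factorsPrime q g h (≡.subst (λ n → C (+ n) *ₚ q ≋ g *ₚ h) isFactorisation e))
  where open PrimeFactorisation (factorise m)

-- `content-split` takes a natural number, so the sign of `s` is moved into `u`.
abs-multiple : ∀ s q → Σ ℤ λ u → C (+ ℤ.∣ s ∣) *ₚ q ≋ C u *ₚ (C s *ₚ q)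
abs-multiple (+ n) q = + 1 , sym (*-identityˡ (C (+ n) *ₚ q))
abs-multiple s@(-[1+ n ]) q = ℤ.- + 1 , trans (*-cong {C (+ suc n)} {C (ℤ.- + 1) *ₚ C s} {q}
  (trans (∷-cong (≡.sym (ℤP.-1*i≡-i s)) refl) (C-homo-* (ℤ.- + 1) s)) refl) (*-assoc (C (ℤ.- + 1)) (C s) q)

-- The integer `m₁` extracted from `q` divides its leading coefficient 1, so the whole constant
-- comes out of the cofactor.
monic-∣-C* : ∀ {q b c} → Monic q → c ≢ + 0 → q ∣ᴾ C c *ₚ b → q ∣ᴾ b
monic-∣-C* {q} {b} {c} (d , top , _) c≢0 (h , e) with abs-multiple c b
... | u , e′ = h′ , trans (*-cong {g = h′} (trans g-≋ (trans
    (*-cong {g = g′} (≡.subst (λ n → C (+ n) ≋ oneₚ) (≡.sym m₁≡1) refl) refl) (*-identityˡ g′))) refl) (sym q-≋)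
  where
  instance
    _ : ℕ.NonZero ℤ.∣ c ∣
    _ = ℤ.≢-nonZero c≢0
  swap : ∀ u q h → u *ₚ (q *ₚ h) ≋ q *ₚ (u *ₚ h)
  swap = solve-∀ polyACR
  open ContentSplit (content-split ℤ.∣ c ∣ {b} q (C u *ₚ h)
    (trans e′ (trans (*-congˡ (C u) (sym e)) (swap (C u) q h))))
  m₁≡1 : m₁ ≡ 1
  m₁≡1 = ℕP.m*n≡1⇒m≡1 m₁ ℤ.∣ coeff g′ d ∣ (≡.trans (≡.sym (ℤP.abs-* (+ m₁) (coeff g′ d)))
    (≡.cong ℤ.∣_∣ (≡.trans (≡.sym (coeff-C* (+ m₁) g′ d)) (≡.trans (≡.sym (at g-≋ d)) top))))

monic-leading : ∀ {f} (m : Monic f) → Leading f (proj₁ m) (+ 1)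
monic-leading (_ , top , above) = top , above

leading-monic : ∀ {f d} → Leading f d (+ 1) → Monic f
leading-monic {d = d} (top , above) = d , top , above

C-*-unit : ∀ {a b} → a ℤ.* b ≡ + 1 → C a *ₚ C b ≋ oneₚ
C-*-unit {a} {b} ab≡1 = trans (sym (C-homo-* a b)) (∷-cong ab≡1 refl)

leading-0-unit : ∀ {f a} b → a ℤ.* b ≡ + 1 → Leading f 0 a → IsUnit f
leading-0-unit {f} {a} b ab≡1 lead =
  C b , at (trans (*-cong {g = C b} (leading-0⇒C lead) refl) (C-*-unit {a} {b} ab≡1))

irreducible-degree : ∀ {q n} → Irreducible q → Leading q n (+ 1) → 0 < n
irreducible-degree {n = zero} (_ , ¬unit , _) lead = contradiction (leading-0-unit (+ 1) ≡.refl lead) ¬unit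
irreducible-degree {n = suc n} _ _ = s≤s z≤n

-- By Gauss's lemma a pseudo-divisor a of q yields a factor of q of the same degree.
irreducible-∣-divisor : ∀ {q n} → Irreducible q → Leading q n (+ 1) →
  ∀ {a e ℓ s} b h → e < n → ℓ ≢ + 0 → Leading a e ℓ → s ≢ + 0 → C s *ₚ q ≋ a *ₚ h →
  q ∣ᴾ a *ₚ b → q ∣ᴾ b
irreducible-∣-divisor {q} {n} irr lead {a} {e} {ℓ} {s} b h e<n ℓ≢0 lead-a s≢0 eq q∣ab =
  conclude (abs-multiple s q)
  where
  instance
    _ : ℕ.NonZero ℤ.∣ s ∣
    _ = ℤ.≢-nonZero s≢0
  swap : ∀ u a h → u *ₚ (a *ₚ h) ≋ a *ₚ (u *ₚ h)
  swap = solve-∀ polyACR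
  regroup : ∀ w m g b → w *ₚ (m *ₚ g *ₚ b) ≋ (g *ₚ w) *ₚ (m *ₚ b)
  regroup = solve-∀ polyACR

  split : ∀ {k} → ContentSplit ℤ.∣ s ∣ q a k → q ∣ᴾ b
  split {k} cs = [ unitˡ , unitʳ ]′ (proj₂ (proj₂ irr) g′ h′ (at (sym q-≋)))
    where
    open ContentSplit cs
    M : Poly
    M = C (+ m₁)

    m₁≢0 : + m₁ ≢ + 0
    m₁≢0 m₁≡0 = s≢0 (ℤP.∣i∣≡0⇒i≡0 (≡.trans m-≡ (≡.cong (ℕ._* m₂) (ℤP.+-injective m₁≡0))))

    -- Here `a` is the constant `m₁` up to a unit, and a monic divisor is insensitive to nonzero
    -- constants.
    unitˡ : IsUnit g′ → q ∣ᴾ b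
    unitˡ (w , g′w≈1) = monic-∣-C* (leading-monic lead) m₁≢0 (∣ˡ-respʳ-≈ eq′ (∣-* w q∣ab))
      where
      open ≋-Reasoning
      eq′ : w *ₚ (a *ₚ b) ≋ M *ₚ b
      eq′ = begin
        w *ₚ (a *ₚ b)            ≈⟨ *-congˡ w (*-cong {a} {M *ₚ g′} {b} g-≋ refl) ⟩
        w *ₚ (M *ₚ g′ *ₚ b)      ≈⟨ regroup w M g′ b ⟩
        (g′ *ₚ w) *ₚ (M *ₚ b)    ≈⟨ *-cong {g′ *ₚ w} {oneₚ} {M *ₚ b} (mk g′w≈1) refl ⟩
        oneₚ *ₚ (M *ₚ b)         ≈⟨ *-identityˡ (M *ₚ b) ⟩
        M *ₚ b                   ∎

    factors-degree : ∀ {c} → c ≢ + 0 → Leading h′ 0 c → Factors g′ h′ n (+ 1) → e ≡ n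
    factors-degree c≢0 lead-h fac = ≡.trans
      (proj₁ (leading-unique ℓ≢0 (*-≢0 m₁≢0 a≢0) lead-a
        (leading-resp-≋ {scale (+ m₁) g′} {a} (trans (sym (C-* (+ m₁) g′)) (sym g-≋)) (leading-scale (+ m₁) leadˡ))))
      (≡.trans (≡.sym (ℕP.+-identityʳ dg))
        (≡.trans (≡.cong (dg ℕ.+_) (proj₁ (leading-unique c≢0 b≢0 lead-h leadʳ))) deg-+))
      where open Factors fac renaming (d to dg; e to dh; a to lg; b to lh)

    -- A constant `h′` would give `a` the full degree `n`, against `e < n`.
    unitʳ : IsUnit h′ → q ∣ᴾ b
    unitʳ unit with unit-leading unit
    ... | c , c≢0 , lead-h = contradiction
      (factors-degree c≢0 lead-h (leading-factors g′ h′ 1≢0 (sym q-≋) lead)) (ℕP.<⇒≢ e<n)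

  conclude : (Σ ℤ λ u → C (+ ℤ.∣ s ∣) *ₚ q ≋ C u *ₚ (C s *ₚ q)) → q ∣ᴾ b
  conclude (u , e′) = split (content-split ℤ.∣ s ∣ {q} a (C u *ₚ h)
    (trans e′ (trans (*-congˡ (C u) eq) (swap (C u) a h))))

-- Descent along the pseudo-remainders of q, as in the Euclidean algorithm.
irreducible-∣-lower : ∀ {q n} → Irreducible q → Leading q n (+ 1) →
  ∀ k {a e ℓ} b → e < k → e < n → ℓ ≢ + 0 → Leading a e ℓ → q ∣ᴾ a *ₚ b → q ∣ᴾ b
irreducible-∣-lower {q} {n} irr lead (suc k) {a} {e} {ℓ} b (s≤s e≤k) e<n ℓ≢0 lead-a q∣ab =
  divide (pseudo-division ℓ≢0 lead-a q)
  where
  distr : ∀ h a b r → h *ₚ (a *ₚ b) +ₚ r *ₚ b ≋ (a *ₚ h +ₚ r) *ₚ b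
  distr = solve-∀ polyACR
  swap : ∀ s q b → s *ₚ q *ₚ b ≋ q *ₚ (s *ₚ b)
  swap = solve-∀ polyACR

  divide : PseudoDivision a e q → q ∣ᴾ b
  divide (s , s≢0 , h , r , eq , r<e) = [ exact , remainder ]′ (leading? r)
    where
    exact : r ≋ [] → q ∣ᴾ b
    exact r≋[] = irreducible-∣-divisor irr lead b h e<n ℓ≢0 lead-a s≢0
      (trans eq (trans (+-congˡ {a *ₚ h} r≋[]) (+-identityʳ (a *ₚ h)))) q∣ab

    eq′ : h *ₚ (a *ₚ b) +ₚ r *ₚ b ≋ q *ₚ (C s *ₚ b)
    eq′ = trans (distr h a b r) (trans (*-cong {a *ₚ h +ₚ r} {C s *ₚ q} {b} (sym eq) refl) (swap (C s) q b))

    remainder : NonZeroLeading r → q ∣ᴾ b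
    remainder (d , c , c≢0 , lead-r) = irreducible-∣-lower irr lead k b
      (ℕP.<-≤-trans d<e e≤k) (ℕP.<-trans d<e e<n) c≢0 lead-r
      (∣-cancel-+ eq′ (∣-* h q∣ab) (C s *ₚ b , refl))
      where
      d<e : d < e
      d<e = deg<-leading c≢0 r<e lead-r

-- Pseudo-division of `a` by `q` decides the case. A zero remainder makes `q` divide a constant
-- multiple of `a`; a nonzero one has lower degree than `q`, and `q` divides its product with `b`,
-- so `irreducible-∣-lower` applies.
irreducible⇒prime : ∀ {q} → Monic q → Irreducible q → ∀ a b → q ∣ᴾ a *ₚ b → q ∣ᴾ a ⊎ q ∣ᴾ b
irreducible⇒prime {q} monic irr a b q∣ab = divide (pseudo-division {q} 1≢0 (monic-leading monic) a)
  where
  distr : ∀ q h b r → q *ₚ (h *ₚ b) +ₚ r *ₚ b ≋ (q *ₚ h +ₚ r) *ₚ b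
  distr = solve-∀ polyACR

  divide : PseudoDivision q (proj₁ monic) a → q ∣ᴾ a ⊎ q ∣ᴾ b
  divide (s , s≢0 , h , r , eq , r<n) = [ inj₁ ∘ exact , inj₂ ∘ remainder ]′ (leading? r)
    where
    exact : r ≋ [] → q ∣ᴾ a
    exact r≋[] = monic-∣-C* monic s≢0
      (h , sym (trans eq (trans (+-congˡ {q *ₚ h} r≋[]) (+-identityʳ (q *ₚ h)))))

    eq′ : q *ₚ (h *ₚ b) +ₚ r *ₚ b ≋ C s *ₚ (a *ₚ b)
    eq′ = trans (distr q h b r) (trans (*-cong {q *ₚ h +ₚ r} {C s *ₚ a} {b} (sym eq) refl) (*-assoc (C s) a b))

    remainder : NonZeroLeading r → q ∣ᴾ b
    remainder (d , c , c≢0 , lead-r) = irreducible-∣-lower irr (monic-leading monic) (suc d) b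
      ℕP.≤-refl (deg<-leading c≢0 r<n lead-r) c≢0 lead-r
      (∣-cancel-+ eq′ (h *ₚ b , refl) (∣-* (C s) q∣ab))

-- Factorisation into monic irreducibles. Irreducibility is not decided, so
-- existence statements are double-negated.

-- If `A` has no monic irreducible divisor, it is itself irreducible: a proper factor would have
-- such a divisor by induction on the degree, bounded by `k`.
irreducible-factor : ∀ k {A n} → n < k → 0 < n → Leading A n (+ 1) →
  ¬ ¬ (Σ[ q ∈ Poly ] Monic q × Irreducible q × q ∣ᴾ A)
irreducible-factor (suc k) {A} {n} (s≤s n≤k) 0<n lead none =
  none (A , leading-monic lead , irreducible , ∣ˡ-refl)
  where
  splits : ∀ a b → (a *ₚ b) ≈ₚ A → Factors a b n (+ 1) → IsUnit a ⊎ IsUnit b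
  splits a b ab≈A record { d = zero ; b = lb ; leadˡ = leadˡ ; lead-* = lead-* } =
    inj₁ (leading-0-unit lb lead-* leadˡ)
  splits a b ab≈A record { d = suc _ ; e = zero ; a = la ; b = lb ; leadʳ = leadʳ ; lead-* = lead-* } =
    inj₂ (leading-0-unit la (≡.trans (ℤP.*-comm lb la) lead-*) leadʳ)
  -- The leading coefficients multiply to 1, so scaling `a` by `lb` makes it monic and the induction
  -- hypothesis applies.
  splits a b ab≈A record { d = d@(suc _) ; e = suc e ; a = la ; b = lb ; leadˡ = leadˡ ; deg-+ = deg-+ ; lead-* = lead-* } =
    contradiction (λ (q , monic , irr , q∣a′) → none (q , monic , irr , ∣ˡ-trans q∣a′ a′∣A))
      (irreducible-factor k (ℕP.<-≤-trans d<n n≤k) (s≤s z≤n) (leading-resp-≋ (sym (C-* lb a))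
        (≡.subst (Leading (scale lb a) d) lb*la≡1 (leading-scale lb leadˡ))))
    where
    lb*la≡1 : lb ℤ.* la ≡ + 1
    lb*la≡1 = ≡.trans (ℤP.*-comm lb la) lead-*
    d<n : d < n
    d<n = ≡.subst (d <_) deg-+ (ℕP.m<m+n d (s≤s z≤n))
    regroup : ∀ l a m b → l *ₚ a *ₚ (m *ₚ b) ≋ (l *ₚ m) *ₚ (a *ₚ b)
    regroup = solve-∀ polyACR
    a′∣A : C lb *ₚ a ∣ᴾ A
    a′∣A = C la *ₚ b , trans (regroup (C lb) a (C la) b)
      (trans (*-cong {C lb *ₚ C la} {oneₚ} {a *ₚ b} (C-*-unit {lb} {la} lb*la≡1) refl) (trans (*-identityˡ (a *ₚ b)) (mk ab≈A)))

  irreducible : Irreducible A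
  irreducible = (λ A≈[] → leading-≢[] 1≢0 lead (mk A≈[])) , ¬unit ,
    λ a b e → splits a b e (leading-factors a b 1≢0 (mk e) lead)
    where
    ¬unit : ¬ IsUnit A
    ¬unit unit with unit-leading unit
    ... | c , c≢0 , lead′ = ℕP.<⇒≢ 0<n (proj₁ (leading-unique c≢0 1≢0 lead′ lead))

MonicIrreducible : Poly → Set
MonicIrreducible q = Monic q × Irreducible q

-- The cofactor of a non-unit divisor of an irreducible is a unit, so the divisibility can be
-- reversed.
irreducible-∣-irreducible : ∀ {q q′} → Irreducible q → ¬ IsUnit q′ → q′ ∣ᴾ q → q ∣ᴾ q′
irreducible-∣-irreducible {q} {q′} irr ¬unit (h , q′h≋q) =
  [ (λ unit → contradiction unit ¬unit) , unit⇒ ]′ (proj₂ (proj₂ irr) q′ h (at q′h≋q))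
  where
  open ≋-Reasoning
  unit⇒ : IsUnit h → q ∣ᴾ q′
  unit⇒ (w , hw≈1) = w , (begin
    q *ₚ w          ≈⟨ *-cong {q} {q′ *ₚ h} {w} (sym q′h≋q) refl ⟩
    q′ *ₚ h *ₚ w    ≈⟨ *-assoc q′ h w ⟩
    q′ *ₚ (h *ₚ w)  ≈⟨ *-congˡ q′ (mk hw≈1) ⟩
    q′ *ₚ oneₚ      ≈⟨ *-comm q′ oneₚ ⟩
    oneₚ *ₚ q′      ≈⟨ *-identityˡ q′ ⟩
    q′              ∎)

*-mono-∣ : ∀ {f g h k} → f *ₚ g ≋ h → k ∣ᴾ g → f *ₚ k ∣ᴾ h
*-mono-∣ {f} {g} {h} {k} fg≋h (l , kl≋g) = l ,
  trans (*-assoc f k l) (trans (*-congˡ f kl≋g) fg≋h)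

monic-cofactor : ∀ {q A₁ A n} → q *ₚ A₁ ≋ A → Monic q → (∀ {d} → Leading q d (+ 1) → 0 < d) →
  Leading A n (+ 1) → ∃ λ e → e < n × Leading A₁ e (+ 1)
monic-cofactor {q} {A₁} {A} {n} qA₁≋A monic deg-q lead = degree (leading-factors q A₁ 1≢0 qA₁≋A lead)
  where
  degree : Factors q A₁ n (+ 1) → ∃ λ e → e < n × Leading A₁ e (+ 1)
  degree fac = e , ≡.subst (e <_) deg-+ (ℕP.m<n+m e (deg-q (≡.subst (Leading q d) a≡1 leadˡ))) ,
    ≡.subst (Leading A₁ e) b≡1 leadʳ
    where
    open Factors fac
    a≡1 : a ≡ + 1
    a≡1 = proj₂ (leading-unique a≢0 1≢0 leadˡ (monic-leading monic))
    b≡1 : b ≡ + 1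
    b≡1 = ≡.trans (≡.sym (ℤP.*-identityˡ b)) (≡.trans (≡.cong (ℤ._* b) (≡.sym a≡1)) lead-*)

-- A monic irreducible factor is removed from both `A` and `B`, and the degree of `A` drops.
-- Squarefreeness guarantees that the remaining irreducible factors of `A` differ from the removed
-- one and so survive in the quotient of `B`.
squarefree-∣ : ∀ k {A n} B → n < k → Leading A n (+ 1) →
  (∀ q → MonicIrreducible q → ¬ q *ₚ q ∣ᴾ A) →
  (∀ q → MonicIrreducible q → q ∣ᴾ A → q ∣ᴾ B) → ¬ ¬ A ∣ᴾ B
squarefree-∣ (suc k) {A} {zero} B _ lead _ _ A∤B =
  A∤B (B , trans (*-cong {A} {oneₚ} {B} (leading-0⇒C lead) refl) (*-identityˡ B))
squarefree-∣ (suc k) {A} {n@(suc _)} B (s≤s n≤k) lead sqfree divs A∤B =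
  irreducible-factor (suc n) ℕP.≤-refl (s≤s z≤n) lead
    λ (q , monic , irr , (A₁ , qA₁≋A)) → remove q monic irr A₁ qA₁≋A (divs q (monic , irr) (A₁ , qA₁≋A))
  where
  remove : ∀ q → Monic q → Irreducible q → ∀ A₁ → q *ₚ A₁ ≋ A → ¬ q ∣ᴾ B
  remove q monic irr A₁ qA₁≋A (B₁ , qB₁≋B) =
    recurse (monic-cofactor {q} qA₁≋A monic (irreducible-degree irr) lead)
    where
    A∣ : ∀ {g} → g ∣ᴾ A₁ → g ∣ᴾ A
    A∣ g∣A₁ = ∣ˡ-respʳ-≈ qA₁≋A (∣-* q g∣A₁)

    divs₁ : ∀ q′ → MonicIrreducible q′ → q′ ∣ᴾ A₁ → q′ ∣ᴾ B₁
    divs₁ q′ (monic′ , irr′) q′∣A₁ = [ absurd , (λ q′∣B₁ → q′∣B₁) ]′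
      (irreducible⇒prime monic′ irr′ q B₁ (∣ˡ-respʳ-≈ (sym qB₁≋B) (divs q′ (monic′ , irr′) (A∣ q′∣A₁))))
      where
      -- Otherwise `q` and `q′` are associates, so `q` divides `A₁` as well and its square divides
      -- `A`.
      absurd : q′ ∣ᴾ q → q′ ∣ᴾ B₁
      absurd q′∣q = contradiction
        (*-mono-∣ {q} {A₁} qA₁≋A (∣ˡ-trans (irreducible-∣-irreducible irr (proj₁ (proj₂ irr′)) q′∣q) q′∣A₁))
        (sqfree q (monic , irr))

    A∣B : ¬ A₁ ∣ᴾ B₁
    A∣B (h , A₁h≋B₁) = A∤B (h , trans (*-cong {A} {q *ₚ A₁} {h} (sym qA₁≋A) refl)
      (trans (*-assoc q A₁ h) (trans (*-congˡ q A₁h≋B₁) qB₁≋B)))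

    recurse : ¬ ∃ λ e → e < n × Leading A₁ e (+ 1)
    recurse (e , e<n , lead-A₁) = squarefree-∣ k B₁ (ℕP.<-≤-trans e<n n≤k) lead-A₁
      (λ q′ mi′ q′²∣A₁ → sqfree q′ mi′ (A∣ q′²∣A₁)) divs₁ A∣B

-- Comparing degrees both ways makes the cofactor `h` constant, and its leading coefficient is 1.
monic-∣-antisym : ∀ {A B} → Monic A → Monic B → A ∣ᴾ B → B ∣ᴾ A → A ≋ B
monic-∣-antisym {A} {B} mA mB (h , Ah≋B) (k , Bk≋A) =
  trans (sym (trans (*-congˡ A h≋1) (trans (*-comm A oneₚ) (*-identityˡ A)))) Ah≋B
  where
  module AB = Factors (leading-factors A h 1≢0 Ah≋B (monic-leading mB))
  module BA = Factors (leading-factors B k 1≢0 Bk≋A (monic-leading mA))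
  degA = leading-unique AB.a≢0 1≢0 AB.leadˡ (monic-leading mA)
  degB = leading-unique BA.a≢0 1≢0 BA.leadˡ (monic-leading mB)
  a b : ℕ
  a = proj₁ mA
  b = proj₁ mB
  a+e≡b : a ℕ.+ AB.e ≡ b
  a+e≡b = ≡.trans (≡.cong (ℕ._+ AB.e) (≡.sym (proj₁ degA))) AB.deg-+
  b≤a : b ≤ a
  b≤a = ≡.subst (b ≤_) (≡.trans (≡.cong (ℕ._+ BA.e) (≡.sym (proj₁ degB))) BA.deg-+) (ℕP.m≤m+n b BA.e)
  e≡0 : AB.e ≡ 0
  e≡0 = ℕP.n≤0⇒n≡0 (ℕP.+-cancelˡ-≤ a AB.e 0
    (≡.subst₂ _≤_ (≡.sym a+e≡b) (≡.sym (ℕP.+-identityʳ a)) b≤a))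
  h≋1 : h ≋ oneₚ
  h≋1 = leading-0⇒C (≡.subst₂ (Leading h) e≡0
    (≡.trans (≡.sym (ℤP.*-identityˡ AB.b)) (≡.trans (≡.cong (ℤ._* AB.b) (≡.sym (proj₂ degA))) AB.lead-*)) AB.leadʳ)

-- Fibonacci polynomials

-- The addition formula; a successor in the second index keeps index -1 out of it.
F-+ : ∀ m n → F (m ℕ.+ suc n) ≋ F (suc m) *ₚ F (suc n) +ₚ F m *ₚ F n
F-+ zero n = sym (trans (+-identityʳ (oneₚ *ₚ F (suc n))) (*-identityˡ (F (suc n))))
F-+ (suc zero) n = eq X (F (suc n)) (F n)
  where
  eq : ∀ x a b → x *ₚ a +ₚ b ≋ (x *ₚ oneₚ +ₚ []) *ₚ a +ₚ oneₚ *ₚ b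
  eq = solve-∀ polyACR
F-+ (suc (suc m)) n = trans (+-cong (*-congˡ X (F-+ (suc m) n)) (F-+ m n))
  (eq X (F (suc m)) (F m) (F (suc n)) (F n))
  where
  eq : ∀ x a b c d → x *ₚ ((x *ₚ a +ₚ b) *ₚ c +ₚ a *ₚ d) +ₚ (a *ₚ c +ₚ b *ₚ d)
    ≋ (x *ₚ (x *ₚ a +ₚ b) +ₚ a) *ₚ c +ₚ (x *ₚ a +ₚ b) *ₚ d
  eq = solve-∀ polyACR

-- Consecutive terms generate the unit ideal of ℤ[x], not merely of ℚ[x], because `F n` enters the
-- recurrence with coefficient 1.
F-bézout : ∀ n → ∃₂ λ u v → u *ₚ F (suc n) +ₚ v *ₚ F n ≋ oneₚ
F-bézout zero = oneₚ , [] , trans (+-identityʳ (oneₚ *ₚ oneₚ)) (*-identityˡ oneₚ)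
F-bézout (suc n) = step (F-bézout n)
  where
  eq : ∀ x a b u v → v *ₚ (x *ₚ a +ₚ b) +ₚ (u +ₚ -ₚ (v *ₚ x)) *ₚ a ≋ u *ₚ a +ₚ v *ₚ b
  eq = solve-∀ polyACR
  step : (∃₂ λ u v → u *ₚ F (suc n) +ₚ v *ₚ F n ≋ oneₚ) →
    ∃₂ λ u v → u *ₚ F (suc (suc n)) +ₚ v *ₚ F (suc n) ≋ oneₚ
  step (u , v , e) = v , u +ₚ -ₚ (v *ₚ X) , trans (eq X (F (suc n)) (F n) u v) e

F-suc-cancel : ∀ n {q f} → q ∣ᴾ F n → q ∣ᴾ F (suc n) *ₚ f → q ∣ᴾ f
F-suc-cancel n {q} {f} q∣Fn q∣Ff = step (F-bézout n)
  where
  eq : ∀ u a v b f → u *ₚ (a *ₚ f) +ₚ v *ₚ f *ₚ b ≋ (u *ₚ a +ₚ v *ₚ b) *ₚ f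
  eq = solve-∀ polyACR
  step : (∃₂ λ u v → u *ₚ F (suc n) +ₚ v *ₚ F n ≋ oneₚ) → q ∣ᴾ f
  step (u , v , e) = ∣ˡ-respʳ-≈ (trans (eq u (F (suc n)) v (F n) f)
    (trans (*-cong {u *ₚ F (suc n) +ₚ v *ₚ F n} {oneₚ} {f} e refl) (*-identityˡ f)))
    (∣-+ (∣-* u q∣Ff) (∣-* (v *ₚ f) q∣Fn))

∣-[] : ∀ f → f ∣ᴾ []
∣-[] f = [] , *-zeroʳ f

F-∣-* : ∀ m k → F m ∣ᴾ F (k ℕ.* m)
F-∣-* m zero = ∣-[] (F m)
F-∣-* zero (suc k) = ≡.subst (λ n → F 0 ∣ᴾ F n) (≡.sym (ℕP.*-zeroʳ (suc k))) ∣ˡ-refl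
F-∣-* m@(suc m′) (suc k) = ≡.subst (λ n → F m ∣ᴾ F n) (ℕP.+-comm (k ℕ.* m) m)
  (∣ˡ-respʳ-≈ (sym (F-+ (k ℕ.* m) m′))
    (∣-+ (∣-* (F (suc (k ℕ.* m))) ∣ˡ-refl) (x∣ˡy⇒x∣ˡyz (F m′) (F-∣-* m k))))

F-mono-∣ : ∀ {m n} → m ∣ n → F m ∣ᴾ F n
F-mono-∣ {m} (ℕD.divides k ≡.refl) = F-∣-* m k

-- In the addition formula for `F (y + d)` the other summand contains `F y`, and the factor
-- `F (suc y)` of the remaining one is coprime to `F y`.
∣-F-difference : ∀ {q} d y {x} → d ℕ.+ y ≡ x → q ∣ᴾ F x → q ∣ᴾ F y → q ∣ᴾ F d
∣-F-difference zero y _ _ _ = ∣-[] _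
∣-F-difference {q} (suc d) y ≡.refl q∣x q∣y = F-suc-cancel y q∣y
  (∣-cancel-+ (trans (+-comm (F y *ₚ F d) _) (sym (F-+ y d))) (x∣ˡy⇒x∣ˡyz (F d) q∣y)
    (≡.subst (λ n → q ∣ᴾ F n) (ℕP.+-comm (suc d) y) q∣x))

-- Bézout over ℕ writes the gcd as a difference of multiples of `m` and `n`, so one difference step
-- replaces a Euclidean recursion on the indices.
∣-F-gcd : ∀ {q} m n → q ∣ᴾ F m → q ∣ᴾ F n → q ∣ᴾ F (gcd m n)
∣-F-gcd {q} m n q∣Fm q∣Fn = from (Bézout.identity (gcd-GCD m n))
  where
  from : Bézout.Identity (gcd m n) m n → q ∣ᴾ F (gcd m n)
  from (Bézout.+- x y eq) = ∣-F-difference (gcd m n) (y ℕ.* n) eq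
    (∣ˡ-trans q∣Fm (F-∣-* m x)) (∣ˡ-trans q∣Fn (F-∣-* n y))
  from (Bézout.-+ x y eq) = ∣-F-difference (gcd m n) (x ℕ.* m) eq
    (∣ˡ-trans q∣Fn (F-∣-* n y)) (∣ˡ-trans q∣Fm (F-∣-* m x))

prime-power-factor : ∀ {p} → Prime p → ∀ k e d → e ℕ.* d ≡ p ^ k → e ≡ 1 ⊎ p ∣ e
prime-power-factor pp zero e d ed≡1 = inj₁ (ℕP.m*n≡1⇒m≡1 e d ed≡1)
prime-power-factor {p} pp (suc k) e d ed≡pᵏ =
  [ inj₂ , p∣d⇒ ]′ (euclidsLemma e d pp (ℕD.divides (p ^ k) (≡.trans ed≡pᵏ (ℕP.*-comm p (p ^ k)))))
  where
  instance _ = prime⇒nonZero pp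
  p∣d⇒ : p ∣ d → e ≡ 1 ⊎ p ∣ e
  p∣d⇒ (ℕD.divides d′ ≡.refl) = prime-power-factor pp k e d′
    (ℕP.*-cancelʳ-≡ (e ℕ.* d′) (p ^ k) p (≡.trans (ℕP.*-assoc e d′ p) (≡.trans ed≡pᵏ (ℕP.*-comm p (p ^ k)))))

proper-∣-prime-power : ∀ {p} → Prime p → ∀ k {d} → d ∣ p ^ suc k → d ≢ p ^ suc k → d ∣ p ^ k
proper-∣-prime-power {p} pp k {d} (ℕD.divides e eq) d≢ =
  [ (λ e≡1 → contradiction (≡.sym (≡.trans eq (≡.trans (≡.cong (ℕ._* d) e≡1) (ℕP.*-identityˡ d)))) d≢) , p∣e⇒ ]′
  (prime-power-factor pp (suc k) e d (≡.sym eq))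
  where
  instance _ = prime⇒nonZero pp
  p∣e⇒ : p ∣ e → d ∣ p ^ k
  p∣e⇒ (ℕD.divides e′ ≡.refl) = ℕD.divides e′ (ℕP.*-cancelˡ-≡ (p ^ k) (e′ ℕ.* d) p
    (≡.trans eq (≡.trans (≡.cong (ℕ._* d) (ℕP.*-comm e′ p)) (ℕP.*-assoc p e′ d))))

-- The gcd of `j` and `p ^ suc k` is a proper divisor of the latter, hence a divisor of `p ^ k`. The
-- condition on all smaller indices thus collapses to the single index `p ^ k`.
∣-F-prime-power : ∀ {p} → Prime p → ∀ k {q j} → 1 ≤ j → j < p ^ suc k →
  q ∣ᴾ F j → q ∣ᴾ F (p ^ suc k) → q ∣ᴾ F (p ^ k)
∣-F-prime-power {p} pp k {q} {j@(suc _)} 1≤j j<n q∣Fj q∣Fn = ∣ˡ-trans (∣-F-gcd j n q∣Fj q∣Fn)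
  (F-mono-∣ (proper-∣-prime-power pp k (gcd[m,n]∣n j n)
    (ℕP.<⇒≢ (ℕP.≤-<-trans (ℕD.∣⇒≤ (gcd[m,n]∣m j n)) j<n))))
  where
  n = p ^ suc k

coeff-X* : ∀ f i → coeff (X *ₚ f) (suc i) ≡ coeff f i
coeff-X* f i = at (X-* f) (suc i)

F-leading : ∀ n → Leading (F (suc n)) n (+ 1)
F-deg< : ∀ n → Deg< (F n) n

F-leading zero = leading-C (+ 1)
F-leading (suc n) = step (F-leading n)
  where
  at-suc : ∀ i → coeff (F (suc (suc n))) (suc i) ≡ coeff (F (suc n)) i ℤ.+ coeff (F n) (suc i)
  at-suc i = ≡.trans (coeff-+ (X *ₚ F (suc n)) (F n) (suc i)) (≡.cong (ℤ._+ coeff (F n) (suc i)) (coeff-X* (F (suc n)) i))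
  step : Leading (F (suc n)) n (+ 1) → Leading (F (suc (suc n))) (suc n) (+ 1)
  step (top , above) = ≡.trans (at-suc n) (≡.cong₂ ℤ._+_ top (F-deg< n (suc n) (ℕP.n≤1+n n))) ,
    λ { (suc i) (s≤s n<i) → ≡.trans (at-suc i) (≡.cong₂ ℤ._+_ (above i n<i)
          (F-deg< n (suc i) (ℕP.≤-trans (ℕP.<⇒≤ n<i) (ℕP.n≤1+n i)))) }

F-deg< zero _ _ = ≡.refl
F-deg< (suc n) = Leading.above (F-leading n)

-- The formal derivative

∂ : Poly → Poly
∂ [] = []
∂ (a ∷ f) = f +ₚ (+ 0 ∷ ∂ f)

coeff-∂ : ∀ f i → coeff (∂ f) i ≡ + suc i ℤ.* coeff f (suc i)
coeff-∂ [] i = ≡.sym (ℤP.*-zeroʳ (+ suc i))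
coeff-∂ (a ∷ f) zero = ≡.trans (coeff-+ f (+ 0 ∷ ∂ f) 0) (≡.trans (ℤP.+-identityʳ _) (≡.sym (ℤP.*-identityˡ _)))
coeff-∂ (a ∷ f) (suc i) = ≡.trans (coeff-+ f (+ 0 ∷ ∂ f) (suc i))
  (≡.trans (≡.cong (λ c → coeff f (suc i) ℤ.+ c) (coeff-∂ f i)) (≡.sym (ℤP.suc-* (+ suc i) (coeff f (suc i)))))

∂-cong : ∀ {f g} → f ≋ g → ∂ f ≋ ∂ g
∂-cong {f} {g} e = mk λ i → ≡.trans (coeff-∂ f i)
  (≡.trans (≡.cong (+ suc i ℤ.*_) (at e (suc i))) (≡.sym (coeff-∂ g i)))

∂-+ : ∀ f g → ∂ (f +ₚ g) ≋ ∂ f +ₚ ∂ g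
∂-+ f g = mk λ i → ≡.trans (coeff-∂ (f +ₚ g) i) (≡.trans (≡.cong (+ suc i ℤ.*_) (coeff-+ f g (suc i)))
  (≡.trans (ℤP.*-distribˡ-+ (+ suc i) (coeff f (suc i)) (coeff g (suc i)))
    (≡.sym (≡.trans (coeff-+ (∂ f) (∂ g) i) (≡.cong₂ ℤ._+_ (coeff-∂ f i) (coeff-∂ g i))))))

∂-scale : ∀ c f → ∂ (scale c f) ≋ scale c (∂ f)
∂-scale c f = mk λ i → ≡.trans (coeff-∂ (scale c f) i) (≡.trans (≡.cong (+ suc i ℤ.*_) (coeff-scale c f (suc i)))
  (≡.trans (swap (+ suc i) c (coeff f (suc i))) (≡.sym (≡.trans (coeff-scale c (∂ f) i) (≡.cong (c ℤ.*_) (coeff-∂ f i))))))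
  where
  swap : ∀ a b c → a ℤ.* (b ℤ.* c) ≡ b ℤ.* (a ℤ.* c)
  swap = solveℤ

∂-X* : ∀ f → ∂ (X *ₚ f) ≋ f +ₚ X *ₚ ∂ f
∂-X* f = trans (∂-cong (X-* f)) (+-congˡ {f} (sym (X-* (∂ f))))

∂-* : ∀ f g → ∂ (f *ₚ g) ≋ ∂ f *ₚ g +ₚ f *ₚ ∂ g
∂-* [] g = refl
∂-* (a ∷ f) g = begin
  ∂ (scale a g +ₚ (+ 0 ∷ f *ₚ g))
    ≈⟨ ∂-+ (scale a g) (+ 0 ∷ f *ₚ g) ⟩
  ∂ (scale a g) +ₚ (f *ₚ g +ₚ (+ 0 ∷ ∂ (f *ₚ g)))
    ≈⟨ +-cong (trans (∂-scale a g) (sym (C-* a (∂ g)))) (+-congˡ {f *ₚ g} (trans (sym (X-* (∂ (f *ₚ g)))) (*-congˡ X (∂-* f g)))) ⟩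
  C a *ₚ ∂ g +ₚ (f *ₚ g +ₚ X *ₚ (∂ f *ₚ g +ₚ f *ₚ ∂ g))
    ≈⟨ regroup (C a) (∂ g) f g X (∂ f) ⟩
  (f +ₚ X *ₚ ∂ f) *ₚ g +ₚ (C a +ₚ X *ₚ f) *ₚ ∂ g
    ≈⟨ +-cong (*-cong {f +ₚ X *ₚ ∂ f} {∂ (a ∷ f)} {g} (+-congˡ {f} (X-* (∂ f))) refl) (*-cong {C a +ₚ X *ₚ f} {a ∷ f} {∂ g} (sym (∷-≋ a f)) refl) ⟩
  ∂ (a ∷ f) *ₚ g +ₚ (a ∷ f) *ₚ ∂ g ∎
  where
  open ≋-Reasoning
  regroup : ∀ a g′ f g x f′ → a *ₚ g′ +ₚ (f *ₚ g +ₚ x *ₚ (f′ *ₚ g +ₚ f *ₚ g′))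
    ≋ (f +ₚ x *ₚ f′) *ₚ g +ₚ (a +ₚ x *ₚ f) *ₚ g′
  regroup = solve-∀ polyACR

square-∣-∂ : ∀ {q f} → q *ₚ q ∣ᴾ f → q ∣ᴾ ∂ f
square-∣-∂ {q} {f} (h , e) = k , (begin
  q *ₚ k                                                  ≈⟨ regroup q h (∂ q) (∂ h) ⟩
  (∂ q *ₚ q +ₚ q *ₚ ∂ q) *ₚ h +ₚ q *ₚ q *ₚ ∂ h            ≈⟨ +-congʳ {g = q *ₚ q *ₚ ∂ h} (*-cong {∂ q *ₚ q +ₚ q *ₚ ∂ q} {∂ (q *ₚ q)} {h} (sym (∂-* q q)) refl) ⟩
  ∂ (q *ₚ q) *ₚ h +ₚ q *ₚ q *ₚ ∂ h                        ≈⟨ ∂-* (q *ₚ q) h ⟨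
  ∂ (q *ₚ q *ₚ h)                                         ≈⟨ ∂-cong e ⟩
  ∂ f                                                     ∎)
  where
  open ≋-Reasoning
  k = ∂ q *ₚ h +ₚ ∂ q *ₚ h +ₚ q *ₚ ∂ h
  regroup : ∀ q h q′ h′ → q *ₚ (q′ *ₚ h +ₚ q′ *ₚ h +ₚ q *ₚ h′)
    ≋ (q′ *ₚ q +ₚ q *ₚ q′) *ₚ h +ₚ q *ₚ q *ₚ h′
  regroup = solve-∀ polyACR

-- The discriminant of t² - x t - 1, the characteristic polynomial of the Fibonacci recurrence.
S : Poly
S = + 4 ∷ + 0 ∷ + 1 ∷ []

S-≋ : S ≋ X *ₚ X +ₚ C (+ 4)
S-≋ = mk λ { 0 → ≡.refl ; 1 → ≡.refl ; 2 → ≡.refl ; (suc (suc (suc _))) → ≡.refl }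

-- (x² + 4) Fₙ′ = n Lₙ − x Fₙ with the Lucas polynomial Lₙ = 2 Fₙ₊₁ − x Fₙ,
-- rearranged so that no subtraction occurs.
∂F-identity : ∀ n → S *ₚ ∂ (F n) +ₚ X *ₚ F n +ₚ C (+ n) *ₚ (X *ₚ F n) ≋ C (+ n) *ₚ (C (+ 2) *ₚ F (suc n))
∂F-identity zero = base S X (C (+ 0)) (C-zero (C (+ 2) *ₚ oneₚ))
  where
  eq : ∀ s x c → s *ₚ [] +ₚ x *ₚ [] +ₚ c *ₚ (x *ₚ []) ≋ []
  eq = solve-∀ polyACR
  base : ∀ s x c → c *ₚ (C (+ 2) *ₚ oneₚ) ≋ [] → s *ₚ [] +ₚ x *ₚ [] +ₚ c *ₚ (x *ₚ []) ≋ c *ₚ (C (+ 2) *ₚ oneₚ)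
  base s x c e = trans (eq s x c) (sym e)
∂F-identity (suc zero) = mk λ { 0 → ≡.refl ; 1 → ≡.refl ; 2 → ≡.refl ; 3 → ≡.refl ; (suc (suc (suc (suc _)))) → ≡.refl }
∂F-identity (suc (suc n)) = begin
  S *ₚ ∂ E +ₚ X *ₚ E +ₚ C (+ suc (suc n)) *ₚ (X *ₚ E)
    ≈⟨ +-congʳ {g = C (+ suc (suc n)) *ₚ (X *ₚ E)} (+-congʳ {g = X *ₚ E} (*-congˡ S (trans (∂-+ (X *ₚ A) B) (+-congʳ {g = ∂ B} (∂-X* A))))) ⟩
  S *ₚ ((A +ₚ X *ₚ ∂ A) +ₚ ∂ B) +ₚ X *ₚ E +ₚ (oneₚ +ₚ (oneₚ +ₚ N)) *ₚ (X *ₚ E)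
    ≈⟨ expand S X A B (∂ A) (∂ B) N ⟩
  rest S X A B N (S *ₚ ∂ A +ₚ X *ₚ A +ₚ (oneₚ +ₚ N) *ₚ (X *ₚ A)) (S *ₚ ∂ B +ₚ X *ₚ B +ₚ N *ₚ (X *ₚ B))
    ≈⟨ rest-cong (∂F-identity (suc n)) (∂F-identity n) ⟩
  rest S X A B N ((oneₚ +ₚ N) *ₚ (C (+ 2) *ₚ E)) (N *ₚ (C (+ 2) *ₚ A))
    -- In the induction step the value of `S` matters only here; elsewhere the solver treats it as
    -- an atom.
    ≈⟨ +-congʳ {g = rest′ X A B N U V} (*-cong {S} {X *ₚ X +ₚ C (+ 4)} {A} S-≋ refl) ⟩
  (X *ₚ X +ₚ C (+ 4)) *ₚ A +ₚ rest′ X A B N U V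
    ≈⟨ collect X A B N ⟩
  C (+ suc (suc n)) *ₚ (C (+ 2) *ₚ (X *ₚ E +ₚ A)) ∎
  where
  open ≋-Reasoning
  A B E N U V : Poly
  A = F (suc n)
  B = F n
  E = F (suc (suc n))
  N = C (+ n)
  U = (oneₚ +ₚ N) *ₚ (C (+ 2) *ₚ E)
  V = N *ₚ (C (+ 2) *ₚ A)

  -- The arguments `u` and `v` are slots for the two induction hypotheses; what their left sides
  -- contain besides the derivative terms is subtracted at the end.
  rest′ : Poly → Poly → Poly → Poly → Poly → Poly → Poly
  rest′ x a b n u v = x *ₚ u +ₚ v +ₚ x *ₚ (x *ₚ a +ₚ b) +ₚ (oneₚ +ₚ (oneₚ +ₚ n)) *ₚ (x *ₚ (x *ₚ a +ₚ b))
    +ₚ -ₚ (x *ₚ (x *ₚ a +ₚ (oneₚ +ₚ n) *ₚ (x *ₚ a)) +ₚ (x *ₚ b +ₚ n *ₚ (x *ₚ b)))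

  rest : Poly → Poly → Poly → Poly → Poly → Poly → Poly → Poly
  rest s x a b n u v = s *ₚ a +ₚ rest′ x a b n u v

  rest-cong : ∀ {u u′ v v′} → u ≋ u′ → v ≋ v′ → rest S X A B N u v ≋ rest S X A B N u′ v′
  rest-cong e e′ = +-congˡ {S *ₚ A} (+-congʳ (+-congʳ (+-congʳ (+-cong (*-congˡ X e) e′))))

  expand : ∀ s x a b a′ b′ n → s *ₚ ((a +ₚ x *ₚ a′) +ₚ b′) +ₚ x *ₚ (x *ₚ a +ₚ b) +ₚ (oneₚ +ₚ (oneₚ +ₚ n)) *ₚ (x *ₚ (x *ₚ a +ₚ b))
    ≋ s *ₚ a +ₚ (x *ₚ (s *ₚ a′ +ₚ x *ₚ a +ₚ (oneₚ +ₚ n) *ₚ (x *ₚ a)) +ₚ (s *ₚ b′ +ₚ x *ₚ b +ₚ n *ₚ (x *ₚ b))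
      +ₚ x *ₚ (x *ₚ a +ₚ b) +ₚ (oneₚ +ₚ (oneₚ +ₚ n)) *ₚ (x *ₚ (x *ₚ a +ₚ b))
      +ₚ -ₚ (x *ₚ (x *ₚ a +ₚ (oneₚ +ₚ n) *ₚ (x *ₚ a)) +ₚ (x *ₚ b +ₚ n *ₚ (x *ₚ b))))
  expand = solve-∀ polyACR

  collect : ∀ x a b n → (x *ₚ x +ₚ C (+ 4)) *ₚ a +ₚ
      (x *ₚ ((oneₚ +ₚ n) *ₚ (C (+ 2) *ₚ (x *ₚ a +ₚ b))) +ₚ n *ₚ (C (+ 2) *ₚ a)
      +ₚ x *ₚ (x *ₚ a +ₚ b) +ₚ (oneₚ +ₚ (oneₚ +ₚ n)) *ₚ (x *ₚ (x *ₚ a +ₚ b))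
      +ₚ -ₚ (x *ₚ (x *ₚ a +ₚ (oneₚ +ₚ n) *ₚ (x *ₚ a)) +ₚ (x *ₚ b +ₚ n *ₚ (x *ₚ b))))
    ≋ (oneₚ +ₚ (oneₚ +ₚ n)) *ₚ (C (+ 2) *ₚ (x *ₚ (x *ₚ a +ₚ b) +ₚ a))
  collect = solve-∀ polyACR

-- The fibotomic polynomial as a quotient

-- The derivative identity makes `q` divide 2n · `F (suc n)`; coprimality of consecutive terms
-- removes `F (suc n)`, and a monic divisor of a nonzero constant divides 1.
F-squarefree : ∀ n q → MonicIrreducible q → ¬ q *ₚ q ∣ᴾ F (suc n)
F-squarefree m q (monic , _ , ¬unit , _) q²∣F@(h , q²h≋F) =
  ¬unit (∣⇒∣ₚ {q} {oneₚ} (monic-∣-C* monic (*-≢0 {+ n} {+ 2} +≢0 +≢0) q∣2n))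
  where
  n = suc m
  q∣F : q ∣ᴾ F n
  q∣F = q *ₚ h , trans (sym (*-assoc q q h)) q²h≋F
  q∣2nF : q ∣ᴾ C (+ n) *ₚ (C (+ 2) *ₚ F (suc n))
  q∣2nF = ∣ˡ-respʳ-≈ (∂F-identity n) (∣-+ (∣-+ (∣-* S (square-∣-∂ q²∣F)) (∣-* X q∣F)) (∣-* (C (+ n)) (∣-* X q∣F)))
  regroup : ∀ a b f → a *ₚ (b *ₚ f) ≋ f *ₚ (a *ₚ b *ₚ oneₚ)
  regroup = solve-∀ polyACR
  q∣2n : q ∣ᴾ C (+ n ℤ.* + 2) *ₚ oneₚ
  q∣2n = F-suc-cancel n q∣F (∣ˡ-respʳ-≈ (trans (regroup (C (+ n)) (C (+ 2)) (F (suc n)))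
    (*-congˡ (F (suc n)) (*-cong {C (+ n) *ₚ C (+ 2)} {C (+ n ℤ.* + 2)} {oneₚ} (sym (C-homo-* (+ n) (+ 2))) refl))) q∣2nF)

monic-quotient : ∀ {f g h} → Monic f → f *ₚ g ≋ h → Monic h → Monic g
monic-quotient {f} {g} {h} mf fg≋h mh = leading-monic (≡.subst (Leading g e) b≡1 leadʳ)
  where
  open Factors (leading-factors f g 1≢0 fg≋h (monic-leading mh))
  b≡1 : b ≡ + 1
  b≡1 = ≡.trans (≡.sym (ℤP.*-identityˡ b)) (≡.trans
    (≡.cong (ℤ._* b) (≡.sym (proj₂ (leading-unique a≢0 1≢0 leadˡ (monic-leading mf))))) lead-*)

-- Equality in ℤ is decidable, hence stable, so the doubly negated divisibilities still yield an
-- honest equality, coefficient by coefficient.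
monic-squarefree-≋ : ∀ {A B} → Monic A → Monic B →
  (∀ q → MonicIrreducible q → ¬ q *ₚ q ∣ᴾ A) → (∀ q → MonicIrreducible q → ¬ q *ₚ q ∣ᴾ B) →
  (∀ q → MonicIrreducible q → q ∣ᴾ A → q ∣ᴾ B) → (∀ q → MonicIrreducible q → q ∣ᴾ B → q ∣ᴾ A) → A ≋ B
monic-squarefree-≋ {A} {B} mA mB sfA sfB A⇒B B⇒A = mk λ i → decidable-stable (coeff A i ℤ.≟ coeff B i) λ ≢ →
  squarefree-∣ (suc (proj₁ mA)) B ℕP.≤-refl (monic-leading mA) sfA A⇒B λ A∣B →
  squarefree-∣ (suc (proj₁ mB)) A ℕP.≤-refl (monic-leading mB) sfB B⇒A λ B∣A →
  ≢ (at (monic-∣-antisym mA mB A∣B B∣A) i)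

F-monic : ∀ n .{{_ : ℕ.NonZero n}} → Monic (F n)
F-monic (suc n) = leading-monic (F-leading n)

F-squarefree′ : ∀ n .{{_ : ℕ.NonZero n}} q → MonicIrreducible q → ¬ q *ₚ q ∣ᴾ F n
F-squarefree′ (suc n) = F-squarefree n

fibotomic-prime-power : ∀ {p} → Prime p → ∀ k {Ψ} → IsFibotomic (p ^ suc k) Ψ →
  F (p ^ k) *ₚ Ψ ≋ F (p ^ suc k)
fibotomic-prime-power {p} pp k {Ψ} (mΨ , sfΨ , factors) = with-cofactor (F-∣-* m p)
  where
  instance _ = prime⇒nonZero pp
  instance _ = ℕP.m^n≢0 p k
  instance _ = ℕP.m^n≢0 p (suc k)
  m n : ℕ
  m = p ^ k
  n = p ^ suc k
  1≤m : 1 ≤ m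
  1≤m = ℕP.m^n>0 p k
  m<n : m < n
  m<n = ℕP.^-monoʳ-< p (ℕ.nonTrivial⇒n>1 p {{prime⇒nonTrivial pp}}) (ℕP.n<1+n k)

  with-cofactor : F m ∣ᴾ F n → F m *ₚ Ψ ≋ F n
  with-cofactor (G , FG≋F) = trans (*-congˡ (F m) Ψ≋G) FG≋F
    where
    ∣F : ∀ {q} → q ∣ᴾ G → q ∣ᴾ F n
    ∣F q∣G = ∣ˡ-respʳ-≈ FG≋F (∣-* (F m) q∣G)

    sfG : ∀ q → MonicIrreducible q → ¬ q *ₚ q ∣ᴾ G
    sfG q mi q²∣G = F-squarefree′ n q mi (∣F q²∣G)

    -- Since `m < n`, the prime element `q` cannot divide `F m`, so it divides the other factor of
    -- `F n`.
    Ψ⇒G : ∀ q → MonicIrreducible q → q ∣ᴾ Ψ → q ∣ᴾ G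
    Ψ⇒G q (monic , irr) q∣Ψ =
      [ (λ q∣Fm → contradiction (∣⇒∣ₚ q∣Fm) (proj₂ divides m 1≤m m<n)) , id ]′
      (irreducible⇒prime monic irr (F m) G (∣ˡ-respʳ-≈ (sym FG≋F) (∣ₚ⇒∣ (proj₁ divides))))
      where
      divides : (q ∣ₚ F n) × (∀ j → 1 ≤ j → j < n → ¬ (q ∣ₚ F j))
      divides = Equivalence.to (factors q monic irr) (∣⇒∣ₚ q∣Ψ)

    -- Dividing an earlier `F j` would make `q` divide `F m` as well as `G`, and its square would
    -- divide `F n`.
    G⇒Ψ : ∀ q → MonicIrreducible q → q ∣ᴾ G → q ∣ᴾ Ψ
    G⇒Ψ q mi@(monic , irr) q∣G@(h , qh≋G) = ∣ₚ⇒∣ (Equivalence.from (factors q monic irr)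
      (∣⇒∣ₚ (∣F q∣G) , λ j 1≤j j<n q∣Fj →
        not-Fm (∣-F-prime-power pp k 1≤j j<n (∣ₚ⇒∣ q∣Fj) (∣F q∣G))))
      where
      regroup : ∀ q h k → q *ₚ q *ₚ (k *ₚ h) ≋ (q *ₚ k) *ₚ (q *ₚ h)
      regroup = solve-∀ polyACR
      not-Fm : ¬ q ∣ᴾ F m
      not-Fm (k , qk≋Fm) = F-squarefree′ n q mi
        (k *ₚ h , trans (regroup q h k) (trans (*-cong qk≋Fm qh≋G) FG≋F))

    Ψ≋G : Ψ ≋ G
    Ψ≋G = monic-squarefree-≋ mΨ (monic-quotient {F m} {G} (F-monic m) FG≋F (F-monic n))
      (λ q (_ , irr) q²∣Ψ → sfΨ q irr (∣⇒∣ₚ q²∣Ψ)) sfG Ψ⇒G G⇒Ψ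

-- A quadratic extension of ℤ[x] modulo a polynomial

infix 4 _≡_mod_
record _≡_mod_ (f g d : Poly) : Set where
  constructor congruent
  field difference : d ∣ᴾ (f +ₚ -ₚ g)
open _≡_mod_

module Mod (d : Poly) where
  ≋⇒mod : ∀ {f g} → f ≋ g → f ≡ g mod d
  ≋⇒mod {f} {g} e = congruent (∣ˡ-respʳ-≈ (sym (trans (+-congʳ {g = -ₚ g} e) (-ₚ-inverseʳ g))) (∣-[] d))

  mod-sym : ∀ {f g} → f ≡ g mod d → g ≡ f mod d
  mod-sym {f} {g} (congruent e) = congruent (∣ˡ-respʳ-≈ (eq f g) (∣-neg e))
    where
    eq : ∀ f g → -ₚ (f +ₚ -ₚ g) ≋ g +ₚ -ₚ f
    eq = solve-∀ polyACR

  mod-trans : ∀ {f g h} → f ≡ g mod d → g ≡ h mod d → f ≡ h mod d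
  mod-trans {f} {g} {h} (congruent e) (congruent e′) = congruent (∣ˡ-respʳ-≈ (eq f g h) (∣-+ e e′))
    where
    eq : ∀ f g h → (f +ₚ -ₚ g) +ₚ (g +ₚ -ₚ h) ≋ f +ₚ -ₚ h
    eq = solve-∀ polyACR

  mod-+ : ∀ {f f′ g g′} → f ≡ f′ mod d → g ≡ g′ mod d → f +ₚ g ≡ f′ +ₚ g′ mod d
  mod-+ {f} {f′} {g} {g′} (congruent e) (congruent e′) = congruent (∣ˡ-respʳ-≈ (eq f f′ g g′) (∣-+ e e′))
    where
    eq : ∀ f f′ g g′ → (f +ₚ -ₚ f′) +ₚ (g +ₚ -ₚ g′) ≋ (f +ₚ g) +ₚ -ₚ (f′ +ₚ g′)
    eq = solve-∀ polyACR

  mod-neg : ∀ {f g} → f ≡ g mod d → -ₚ f ≡ -ₚ g mod d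
  mod-neg {f} {g} (congruent e) = congruent (∣ˡ-respʳ-≈ (eq f g) (∣-neg e))
    where
    eq : ∀ f g → -ₚ (f +ₚ -ₚ g) ≋ -ₚ f +ₚ -ₚ (-ₚ g)
    eq = solve-∀ polyACR

  mod-* : ∀ {f f′ g g′} → f ≡ f′ mod d → g ≡ g′ mod d → f *ₚ g ≡ f′ *ₚ g′ mod d
  mod-* {f} {f′} {g} {g′} (congruent e) (congruent e′) = congruent (∣ˡ-respʳ-≈ (eq f f′ g g′) (∣-+ (∣-* g e) (∣-* f′ e′)))
    where
    eq : ∀ f f′ g g′ → g *ₚ (f +ₚ -ₚ f′) +ₚ f′ *ₚ (g +ₚ -ₚ g′) ≋ f *ₚ g +ₚ -ₚ (f′ *ₚ g′)
    eq = solve-∀ polyACR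

  -- The elements u + v α of (ℤ[x] / d)[α] with α² = x α + 1.
  record Quad : Set where
    constructor _⊕_α
    field re im : Poly
  open Quad

  infix 4 _≈_
  record _≈_ (z w : Quad) : Set where
    constructor _,_
    field
      re-mod : re z ≡ re w mod d
      im-mod : im z ≡ im w mod d

  infixl 6 _+_
  infixl 7 _*_
  _+_ _*_ : Quad → Quad → Quad
  (u ⊕ v α) + (u′ ⊕ v′ α) = (u +ₚ u′) ⊕ (v +ₚ v′) α
  (u ⊕ v α) * (u′ ⊕ v′ α) = (u *ₚ u′ +ₚ v *ₚ v′) ⊕ (u *ₚ v′ +ₚ v *ₚ u′ +ₚ X *ₚ (v *ₚ v′)) α

  -_ : Quad → Quad
  - (u ⊕ v α) = (-ₚ u) ⊕ (-ₚ v) α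

  0# 1# : Quad
  0# = [] ⊕ [] α
  1# = oneₚ ⊕ [] α

  ≋⇒≈ : ∀ {u u′ v v′} → u ≋ u′ → v ≋ v′ → (u ⊕ v α) ≈ (u′ ⊕ v′ α)
  ≋⇒≈ e e′ = ≋⇒mod e , ≋⇒mod e′

  *-cong′ : ∀ {z z′ w w′} → z ≈ z′ → w ≈ w′ → z * w ≈ z′ * w′
  *-cong′ (e₁ , e₂) (e₃ , e₄) = mod-+ (mod-* e₁ e₃) (mod-* e₂ e₄) ,
    mod-+ (mod-+ (mod-* e₁ e₄) (mod-* e₂ e₃)) (mod-* (≋⇒mod {X} refl) (mod-* e₂ e₄))

  *-assoc′ : ∀ z w t → (z * w) * t ≈ z * (w * t)
  *-assoc′ (u ⊕ v α) (u′ ⊕ v′ α) (u″ ⊕ v″ α) = ≋⇒≈ (re-eq X u v u′ v′ u″ v″) (im-eq X u v u′ v′ u″ v″)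
    where
    re-eq : ∀ x u v u′ v′ u″ v″ →
      (u *ₚ u′ +ₚ v *ₚ v′) *ₚ u″ +ₚ (u *ₚ v′ +ₚ v *ₚ u′ +ₚ x *ₚ (v *ₚ v′)) *ₚ v″
      ≋ u *ₚ (u′ *ₚ u″ +ₚ v′ *ₚ v″) +ₚ v *ₚ (u′ *ₚ v″ +ₚ v′ *ₚ u″ +ₚ x *ₚ (v′ *ₚ v″))
    re-eq = solve-∀ polyACR
    im-eq : ∀ x u v u′ v′ u″ v″ →
      (u *ₚ u′ +ₚ v *ₚ v′) *ₚ v″ +ₚ (u *ₚ v′ +ₚ v *ₚ u′ +ₚ x *ₚ (v *ₚ v′)) *ₚ u″
        +ₚ x *ₚ ((u *ₚ v′ +ₚ v *ₚ u′ +ₚ x *ₚ (v *ₚ v′)) *ₚ v″)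
      ≋ u *ₚ (u′ *ₚ v″ +ₚ v′ *ₚ u″ +ₚ x *ₚ (v′ *ₚ v″)) +ₚ v *ₚ (u′ *ₚ u″ +ₚ v′ *ₚ v″)
        +ₚ x *ₚ (v *ₚ (u′ *ₚ v″ +ₚ v′ *ₚ u″ +ₚ x *ₚ (v′ *ₚ v″)))
    im-eq = solve-∀ polyACR

  *-comm′ : ∀ z w → z * w ≈ w * z
  *-comm′ (u ⊕ v α) (u′ ⊕ v′ α) = ≋⇒≈ (re-eq u v u′ v′) (im-eq X u v u′ v′)
    where
    re-eq : ∀ u v u′ v′ → u *ₚ u′ +ₚ v *ₚ v′ ≋ u′ *ₚ u +ₚ v′ *ₚ v
    re-eq = solve-∀ polyACR
    im-eq : ∀ x u v u′ v′ → u *ₚ v′ +ₚ v *ₚ u′ +ₚ x *ₚ (v *ₚ v′) ≋ u′ *ₚ v +ₚ v′ *ₚ u +ₚ x *ₚ (v′ *ₚ v)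
    im-eq = solve-∀ polyACR

  *-identityˡ′ : ∀ z → 1# * z ≈ z
  *-identityˡ′ (u ⊕ v α) = ≋⇒≈ (re-eq u v) (im-eq X u v)
    where
    re-eq : ∀ u v → oneₚ *ₚ u +ₚ [] *ₚ v ≋ u
    re-eq = solve-∀ polyACR
    im-eq : ∀ x u v → oneₚ *ₚ v +ₚ [] *ₚ u +ₚ x *ₚ ([] *ₚ v) ≋ v
    im-eq = solve-∀ polyACR

  distribˡ′ : ∀ z w t → z * (w + t) ≈ z * w + z * t
  distribˡ′ (u ⊕ v α) (u′ ⊕ v′ α) (u″ ⊕ v″ α) = ≋⇒≈ (re-eq u v u′ v′ u″ v″) (im-eq X u v u′ v′ u″ v″)
    where
    re-eq : ∀ u v u′ v′ u″ v″ → u *ₚ (u′ +ₚ u″) +ₚ v *ₚ (v′ +ₚ v″)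
      ≋ (u *ₚ u′ +ₚ v *ₚ v′) +ₚ (u *ₚ u″ +ₚ v *ₚ v″)
    re-eq = solve-∀ polyACR
    im-eq : ∀ x u v u′ v′ u″ v″ → u *ₚ (v′ +ₚ v″) +ₚ v *ₚ (u′ +ₚ u″) +ₚ x *ₚ (v *ₚ (v′ +ₚ v″))
      ≋ (u *ₚ v′ +ₚ v *ₚ u′ +ₚ x *ₚ (v *ₚ v′)) +ₚ (u *ₚ v″ +ₚ v *ₚ u″ +ₚ x *ₚ (v *ₚ v″))
    im-eq = solve-∀ polyACR

  ≈-refl : ∀ {z} → z ≈ z
  ≈-refl = ≋⇒mod refl , ≋⇒mod refl

  ≈-trans : ∀ {z w t} → z ≈ w → w ≈ t → z ≈ t
  ≈-trans (e , e′) (f , f′) = mod-trans e f , mod-trans e′ f′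

  +-cong′ : ∀ {z z′ w w′} → z ≈ z′ → w ≈ w′ → z + w ≈ z′ + w′
  +-cong′ (e , e′) (f , f′) = mod-+ e f , mod-+ e′ f′

  +-comm′ : ∀ z w → z + w ≈ w + z
  +-comm′ (u ⊕ v α) (u′ ⊕ v′ α) = ≋⇒≈ (+-comm u u′) (+-comm v v′)

  -‿inverseʳ′ : ∀ z → z + - z ≈ 0#
  -‿inverseʳ′ (u ⊕ v α) = ≋⇒≈ (-ₚ-inverseʳ u) (-ₚ-inverseʳ v)

  quadRing : CommutativeRing 0ℓ 0ℓ
  quadRing = record
    { Carrier = Quad ; _≈_ = _≈_ ; _+_ = _+_ ; _*_ = _*_ ; -_ = -_ ; 0# = 0# ; 1# = 1#
    ; isCommutativeRing = record
      { isRing = record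
        { +-isAbelianGroup = record
          { isGroup = record
            { isMonoid = record
              { isSemigroup = record
                { isMagma = record
                  { isEquivalence = record
                    { refl = ≈-refl
                    ; sym = λ (e , e′) → mod-sym e , mod-sym e′
                    ; trans = ≈-trans
                    }
                  ; ∙-cong = +-cong′
                  }
                ; assoc = λ (u ⊕ v α) (u′ ⊕ v′ α) (u″ ⊕ v″ α) → ≋⇒≈ (+-assoc u u′ u″) (+-assoc v v′ v″)
                }
              ; identity = (λ _ → ≈-refl) , λ (u ⊕ v α) → ≋⇒≈ (+-identityʳ u) (+-identityʳ v)
              }
            ; inverse = (λ z → ≈-trans (+-comm′ (- z) z) (-‿inverseʳ′ z)) , -‿inverseʳ′
            ; ⁻¹-cong = λ (e , e′) → mod-neg e , mod-neg e′
            }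
          ; comm = +-comm′
          }
        ; *-cong = *-cong′
        ; *-assoc = *-assoc′
        ; *-identity = *-identityˡ′ , λ z → ≈-trans (*-comm′ z 1#) (*-identityˡ′ z)
        ; distrib = distribˡ′ , λ z w t → ≈-trans (*-comm′ (w + t) z)
            (≈-trans (distribˡ′ z w t) (+-cong′ (*-comm′ z w) (*-comm′ z t)))
        }
      ; *-comm = *-comm′
      }
    }

-- Frobenius applied to the difference of the conjugate roots

module FibonacciMod {p} (pp : Prime p) where
  open Mod (C (+ p))
  private module Q = CommutativeRing quadRing
  open Q using (commutativeSemiring; semiring) renaming (setoid to quadSetoid)
  open import Algebra.Properties.CommutativeSemiring.Exp commutativeSemiring using (^-distrib-*) renaming (_^_ to _↑_)
  open import Algebra.Properties.Semiring.Exp semiring using (^-congˡ)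
  open import Algebra.Properties.Semiring.Mult semiring renaming (_×_ to _·_)
  open import Relation.Binary.Reasoning.Setoid quadSetoid
  open Frobenius commutativeSemiring using (frobenius-^)

  ·1≈C : ∀ n → n · 1# ≈ (C (+ n) ⊕ [] α)
  ·1≈C zero = ≋⇒≈ (sym 0∷[]≋[]) refl
  ·1≈C (suc n) = Q.+-cong {1#} (≈-refl) (·1≈C n)

  p·1≈0 : p · 1# ≈ 0#
  p·1≈0 = ≈-trans (·1≈C p) (congruent (oneₚ , eq (C (+ p))) , ≋⇒mod refl)
    where
    eq : ∀ c → c *ₚ oneₚ ≋ c +ₚ -ₚ []
    eq = solve-∀ polyACR

  -- These are α, its conjugate β = x - α, and α - β = 2 α - x.
  a b δ : Quad
  a = [] ⊕ oneₚ α
  b = X ⊕ -ₚ oneₚ α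
  δ = (-ₚ X) ⊕ C (+ 2) α

  a-power : ∀ n → a ↑ suc n ≈ (F n ⊕ F (suc n) α)
  a-power zero = ≋⇒≈ (re-eq) (im-eq X)
    where
    re-eq : [] *ₚ oneₚ +ₚ oneₚ *ₚ [] ≋ []
    re-eq = mk λ { zero → ≡.refl ; (suc _) → ≡.refl }
    im-eq : ∀ x → [] *ₚ [] +ₚ oneₚ *ₚ oneₚ +ₚ x *ₚ (oneₚ *ₚ []) ≋ oneₚ
    im-eq = solve-∀ polyACR
  a-power (suc n) = ≈-trans (Q.*-cong {a} ≈-refl (a-power n)) (≋⇒≈ (re-eq (F n) (F (suc n))) (im-eq X (F n) (F (suc n))))
    where
    re-eq : ∀ f g → [] *ₚ f +ₚ oneₚ *ₚ g ≋ g
    re-eq = solve-∀ polyACR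
    im-eq : ∀ x f g → [] *ₚ g +ₚ oneₚ *ₚ f +ₚ x *ₚ (oneₚ *ₚ g) ≋ x *ₚ g +ₚ f
    im-eq = solve-∀ polyACR

  -- The conjugate of `a-power`: x - α takes the place of α on its right side.
  b-power : ∀ n → b ↑ suc n ≈ ((F n +ₚ X *ₚ F (suc n)) ⊕ -ₚ F (suc n) α)
  b-power zero = ≋⇒≈ (re-eq X) (im-eq X)
    where
    re-eq : ∀ x → x *ₚ oneₚ +ₚ -ₚ oneₚ *ₚ [] ≋ [] +ₚ x *ₚ oneₚ
    re-eq = solve-∀ polyACR
    im-eq : ∀ x → x *ₚ [] +ₚ -ₚ oneₚ *ₚ oneₚ +ₚ x *ₚ (-ₚ oneₚ *ₚ []) ≋ -ₚ oneₚ
    im-eq = solve-∀ polyACR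
  b-power (suc n) = ≈-trans (Q.*-cong {b} ≈-refl (b-power n)) (≋⇒≈ (re-eq X (F n) (F (suc n))) (im-eq X (F n) (F (suc n))))
    where
    re-eq : ∀ x f g → x *ₚ (f +ₚ x *ₚ g) +ₚ -ₚ oneₚ *ₚ -ₚ g ≋ g +ₚ x *ₚ (x *ₚ g +ₚ f)
    re-eq = solve-∀ polyACR
    im-eq : ∀ x f g → x *ₚ -ₚ g +ₚ -ₚ oneₚ *ₚ (f +ₚ x *ₚ g) +ₚ x *ₚ (-ₚ oneₚ *ₚ -ₚ g) ≋ -ₚ (x *ₚ g +ₚ f)
    im-eq = solve-∀ polyACR

  S-power : ∀ n → (S ⊕ [] α) ↑ n ≈ ((S ^ₚ n) ⊕ [] α)
  S-power zero = ≈-refl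
  S-power (suc n) = ≈-trans (Q.*-cong {S ⊕ [] α} ≈-refl (S-power n)) (≋⇒≈ (re-eq S (S ^ₚ n)) (im-eq X S (S ^ₚ n)))
    where
    re-eq : ∀ s t → s *ₚ t +ₚ [] *ₚ [] ≋ s *ₚ t
    re-eq = solve-∀ polyACR
    im-eq : ∀ x s t → s *ₚ [] +ₚ [] *ₚ t +ₚ x *ₚ ([] *ₚ []) ≋ []
    im-eq = solve-∀ polyACR

  δ² : δ * δ ≈ (S ⊕ [] α)
  δ² = ≋⇒≈ (trans (re-eq X) (sym S-≋)) (im-eq X)
    where
    re-eq : ∀ x → -ₚ x *ₚ -ₚ x +ₚ C (+ 2) *ₚ C (+ 2) ≋ x *ₚ x +ₚ C (+ 4)
    re-eq = solve-∀ polyACR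
    im-eq : ∀ x → -ₚ x *ₚ C (+ 2) +ₚ C (+ 2) *ₚ -ₚ x +ₚ x *ₚ (C (+ 2) *ₚ C (+ 2)) ≋ []
    im-eq = solve-∀ polyACR

  δ+b≈a : δ + b ≈ a
  δ+b≈a = ≋⇒≈ (re-eq X) (mk λ { zero → ≡.refl ; (suc _) → ≡.refl })
    where
    re-eq : ∀ x → -ₚ x +ₚ x ≋ []
    re-eq = solve-∀ polyACR

  +-cancelʳ : ∀ {z w t} → z + w ≈ t → z ≈ t + - w
  +-cancelʳ {z@(u ⊕ v α)} {w@(u′ ⊕ v′ α)} {t} e =
    ≈-trans (≋⇒≈ (eq u u′) (eq v v′)) (Q.+-congʳ e)
    where
    eq : ∀ u u′ → u ≋ u +ₚ u′ +ₚ -ₚ u′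
    eq = solve-∀ polyACR

  -- Frobenius is applied to α = δ + β rather than to α - β, so no sign of (-β)^n has to be
  -- determined.
  δ-power : ∀ k → δ ↑ (p ^ k) ≈ (F (p ^ k) ⊕ [] α) * δ
  δ-power k = via (p ^ k) (ℕP.m^n≢0 p k {{prime⇒nonZero pp}}) (begin
    δ ↑ (p ^ k) + b ↑ (p ^ k)   ≈⟨ frobenius-^ pp p·1≈0 k δ b ⟨
    (δ + b) ↑ (p ^ k)           ≈⟨ ^-congˡ (p ^ k) δ+b≈a ⟩
    a ↑ (p ^ k)                 ∎)
    where
    via : ∀ n → ℕ.NonZero n → δ ↑ n + b ↑ n ≈ a ↑ n → δ ↑ n ≈ (F n ⊕ [] α) * δ
    via (suc n) _ e = begin
      δ ↑ suc n
        ≈⟨ +-cancelʳ e ⟩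
      a ↑ suc n + - (b ↑ suc n)
        ≈⟨ Q.+-cong (a-power n) (Q.-‿cong (b-power n)) ⟩
      (F n ⊕ F (suc n) α) + - ((F n +ₚ X *ₚ F (suc n)) ⊕ -ₚ F (suc n) α)
        ≈⟨ ≋⇒≈ (re-eq X (F n) (F (suc n))) (im-eq X (F (suc n))) ⟩
      (F (suc n) ⊕ [] α) * δ ∎
      where
      re-eq : ∀ x f g → f +ₚ -ₚ (f +ₚ x *ₚ g) ≋ g *ₚ -ₚ x +ₚ [] *ₚ C (+ 2)
      re-eq = solve-∀ polyACR
      im-eq : ∀ x g → g +ₚ -ₚ (-ₚ g) ≋ g *ₚ C (+ 2) +ₚ [] *ₚ -ₚ x +ₚ x *ₚ ([] *ₚ C (+ 2))
      im-eq = solve-∀ polyACR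

  -- Squaring `δ-power` turns `δ` into `S`, so both sides lie in ℤ[x] and the components free of α
  -- can be compared.
  S*F²-mod : ∀ k → S ^ₚ (p ^ k) ≡ F (p ^ k) *ₚ F (p ^ k) *ₚ S mod C (+ p)
  S*F²-mod k = _≈_.re-mod (begin
    (S ^ₚ n) ⊕ [] α                    ≈⟨ S-power n ⟨
    (S ⊕ [] α) ↑ n                     ≈⟨ ^-congˡ n δ² ⟨
    (δ * δ) ↑ n                        ≈⟨ ^-distrib-* δ δ n ⟩
    δ ↑ n * δ ↑ n                      ≈⟨ Q.*-cong (δ-power k) (δ-power k) ⟩
    (f * δ) * (f * δ)                  ≈⟨ interchange f δ f δ ⟩
    (f * f) * (δ * δ)                  ≈⟨ Q.*-cong {f * f} ≈-refl δ² ⟩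
    (f * f) * (S ⊕ [] α)               ≈⟨ ≋⇒≈ (re-eq (F n) S) (im-eq X (F n) S) ⟩
    (F n *ₚ F n *ₚ S) ⊕ [] α           ∎)
    where
    open import Algebra.Properties.CommutativeSemigroup Q.*-commutativeSemigroup using (interchange)
    n : ℕ
    n = p ^ k
    f : Quad
    f = F n ⊕ [] α
    re-eq : ∀ f s → (f *ₚ f +ₚ [] *ₚ []) *ₚ s +ₚ (f *ₚ [] +ₚ [] *ₚ f +ₚ X *ₚ ([] *ₚ [])) *ₚ [] ≋ f *ₚ f *ₚ s
    re-eq = solve-∀ polyACR
    im-eq : ∀ x f s → (f *ₚ f +ₚ [] *ₚ []) *ₚ [] +ₚ (f *ₚ [] +ₚ [] *ₚ f +ₚ x *ₚ ([] *ₚ [])) *ₚ s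
      +ₚ x *ₚ ((f *ₚ [] +ₚ [] *ₚ f +ₚ x *ₚ ([] *ₚ [])) *ₚ []) ≋ []
    im-eq = solve-∀ polyACR

-- Euler's totient at a prime power

module _ {P : Pred ℕ 0ℓ} (P? : Decidable P) where
  count : ℕ → ℕ
  count n = length (filter P? (map suc (upTo n)))

  count-suc : ∀ n → count (suc n) ≡ count n ℕ.+ length (filter P? (suc n ∷ []))
  count-suc n = begin
    length (filter P? (map suc (upTo (suc n))))                      ≡⟨ ≡.cong (λ l → length (filter P? (map suc l))) (upTo-∷ʳ n) ⟨
    length (filter P? (map suc (upTo n ∷ʳ n)))                       ≡⟨ ≡.cong (λ l → length (filter P? l)) (map-++ suc (upTo n) (n ∷ [])) ⟩
    length (filter P? (map suc (upTo n) ++ suc n ∷ []))              ≡⟨ ≡.cong length (filter-++ P? (map suc (upTo n)) (suc n ∷ [])) ⟩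
    length (filter P? (map suc (upTo n)) ++ filter P? (suc n ∷ []))  ≡⟨ length-++ (filter P? (map suc (upTo n))) ⟩
    count n ℕ.+ length (filter P? (suc n ∷ []))                      ∎
    where open ≡.≡-Reasoning

  count-accept : ∀ n → P (suc n) → count (suc n) ≡ suc (count n)
  count-accept n Pn = ≡.trans (count-suc n)
    (≡.trans (≡.cong (λ l → count n ℕ.+ length l) (filter-accept P? Pn)) (ℕP.+-comm (count n) 1))

  count-reject : ∀ n → ¬ P (suc n) → count (suc n) ≡ count n
  count-reject n ¬Pn = ≡.trans (count-suc n)
    (≡.trans (≡.cong (λ l → count n ℕ.+ length l) (filter-reject P? ¬Pn)) (ℕP.+-identityʳ (count n)))

  -- The range is traversed in blocks of length p: `j` is the position inside the current block, and
  -- a multiple of p is met only on completing a block.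
  count-nonmultiples : ∀ {p-1} → (∀ {m} → suc p-1 ∣ m → ¬ P m) → (∀ {m} → ¬ suc p-1 ∣ m → P m) →
    ∀ N j → j ≤ p-1 → count (j ℕ.+ N ℕ.* suc p-1) ≡ j ℕ.+ N ℕ.* p-1
  count-nonmultiples mult nonmult zero zero _ = ≡.refl
  count-nonmultiples {p-1} mult nonmult (suc N) zero _ = ≡.trans
    (count-reject (p-1 ℕ.+ N ℕ.* suc p-1) (mult (ℕD.divides (suc N) ≡.refl)))
    (count-nonmultiples mult nonmult N p-1 ℕP.≤-refl)
  count-nonmultiples {p-1} mult nonmult N (suc j) j<p = ≡.trans
    (count-accept (j ℕ.+ N ℕ.* suc p-1)
      (nonmult λ p∣ → ℕD.>⇒∤ (s≤s j<p) (ℕD.∣m+n∣m⇒∣n {n = suc j} (≡.subst (suc p-1 ℕD.∣_) (ℕP.+-comm (suc j) (N ℕ.* suc p-1)) p∣) (ℕD.divides N ≡.refl))))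
    (≡.cong suc (count-nonmultiples mult nonmult N j (ℕP.<⇒≤ j<p)))

-- Being coprime to a positive power of p means not being a multiple of p. The additive form avoids
-- truncated subtraction.
φ-prime-power : ∀ {p} → Prime p → ∀ k → φ (p ^ suc k) ℕ.+ p ^ k ≡ p ^ suc k
φ-prime-power {zero} pp = contradiction pp ¬prime[0]
φ-prime-power {p@(suc p-1)} pp k = begin
  count coprime-n? (p ℕ.* m) ℕ.+ m      ≡⟨ ≡.cong (λ t → count coprime-n? t ℕ.+ m) (ℕP.*-comm p m) ⟩
  count coprime-n? (m ℕ.* p) ℕ.+ m      ≡⟨ ≡.cong (ℕ._+ m) (count-nonmultiples coprime-n? mult nonmult m 0 z≤n) ⟩
  m ℕ.* p-1 ℕ.+ m                       ≡⟨ ℕP.+-comm (m ℕ.* p-1) m ⟩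
  m ℕ.+ m ℕ.* p-1                       ≡⟨ ℕP.*-suc m p-1 ⟨
  m ℕ.* p                               ≡⟨ ℕP.*-comm m p ⟩
  p ℕ.* m                               ∎
  where
  open ≡.≡-Reasoning
  m n : ℕ
  m = p ^ k
  n = p ^ suc k
  coprime-n? : Decidable (λ i → Coprime i n)
  coprime-n? i = coprime? i n
  mult : ∀ {i} → p ∣ i → ¬ Coprime i n
  mult p∣i coprime = contradiction (coprime (p∣i , ℕD.m∣m*n m)) (ℕ.nonTrivial⇒≢1 {{prime⇒nonTrivial pp}})
  nonmult : ∀ {i} → ¬ p ∣ i → Coprime i n
  nonmult p∤i {d} (d∣i , d∣n@(ℕD.divides e n≡ed)) =
    [ id , (λ p∣d → contradiction (ℕD.∣-trans p∣d d∣i) p∤i) ]′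
    (prime-power-factor pp (suc k) d e (≡.trans (ℕP.*-comm d e) (≡.sym n≡ed)))

-- Monic polynomials modulo p and extraction of the square root

^ₚ-+ : ∀ f m n → f ^ₚ (m ℕ.+ n) ≋ (f ^ₚ m) *ₚ (f ^ₚ n)
^ₚ-+ f zero n = sym (*-identityˡ (f ^ₚ n))
^ₚ-+ f (suc m) n = trans (*-congˡ f (^ₚ-+ f m n)) (sym (*-assoc f (f ^ₚ m) (f ^ₚ n)))

monic-^ : ∀ f → Monic f → ∀ n → Monic (f ^ₚ n)
monic-^ f mf zero = leading-monic (leading-C (+ 1))
monic-^ f mf (suc n) = leading-monic (leading-* f (f ^ₚ n) (monic-leading mf) (monic-leading (monic-^ f mf n)))

S-monic : Monic S
S-monic = 2 , ≡.refl , λ { (suc (suc (suc _))) _ → ≡.refl ; (suc (suc zero)) (s≤s (s≤s ())) ; (suc zero) (s≤s ()) ; zero () }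

∤1 : ∀ {p} → Prime p → ¬ + p ℤS.∣ + 1
∤1 pp p∣1 = contradiction (ℕD.∣1⇒≡1 (ℤS.∣⇒∣ᵤ p∣1)) (ℕ.nonTrivial⇒≢1 {{prime⇒nonTrivial pp}})

C-∤-monic : ∀ {p} → Prime p → ∀ {f} → Monic f → ¬ C (+ p) ∣ᴾ f
C-∤-monic {p} pp (d , top , _) p∣f = ∤1 pp (≡.subst (+ p ℤS.∣_) top (∣-coeff p∣f d))

-- At the larger of the two degrees the sum has coefficient 1, or 2 if the degrees agree, and p does
-- not divide 1.
monic-sum-∣ : ∀ {p} → Prime p → ∀ f g → Monic f → Monic g → C (+ p) ∣ᴾ f +ₚ g → + p ℤS.∣ + 2
monic-sum-∣ {p} pp f g (d , top-f , above-f) (e , top-g , above-g) p∣f+g = compare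
  where
  at-degree : ∀ i {a b} → coeff f i ≡ a → coeff g i ≡ b → + p ℤS.∣ a ℤ.+ b
  at-degree i f≡a g≡b = ≡.subst (+ p ℤS.∣_) (≡.trans (coeff-+ f g i) (≡.cong₂ ℤ._+_ f≡a g≡b)) (∣-coeff p∣f+g i)
  compare : + p ℤS.∣ + 2
  compare with ℕP.<-cmp d e
  ... | tri< d<e _ _ = contradiction (at-degree e (above-f e d<e) top-g) (∤1 pp)
  ... | tri≈ _ ≡.refl _ = at-degree d top-f top-g
  ... | tri> _ _ e<d = contradiction (at-degree d top-f (above-g d e<d)) (∤1 pp)

∣⇒ModEq : ∀ {p f g} → C (+ p) ∣ᴾ f +ₚ -ₚ g → ModEq p f g
∣⇒ModEq {p} {f} {g} p∣f-g i = ℤS.∣⇒∣ᵤ (≡.subst (+ p ℤS.∣_) (≡.trans (coeff-+ f (-ₚ g) i)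
  (≡.cong (λ c → coeff f i ℤ.+ c) (≡.trans (coeff-scale (ℤ.- + 1) g i) (ℤP.-1*i≡-i (coeff g i))))) (∣-coeff p∣f-g i))

-- Modulo p, `S ^ₚ m` agrees with the square of `F m` times `S`, so multiplying by it completes the
-- square of `Ψ` to that of `F n`. Being monic, `S ^ₚ m` is not divisible by p and can be cancelled.
fibotomic²-mod : ∀ {p} → Prime p → ∀ k {Ψ} → IsFibotomic (p ^ suc k) Ψ →
  C (+ p) ∣ᴾ Ψ *ₚ Ψ +ₚ -ₚ (S ^ₚ φ (p ^ suc k))
fibotomic²-mod {p} pp k {Ψ} fib =
  [ (λ p∣Sᵐ → contradiction p∣Sᵐ (C-∤-monic pp (monic-^ S S-monic m))) , id ]′
  (C-prime pp (S ^ₚ m) (Ψ *ₚ Ψ +ₚ -ₚ (S ^ₚ q)) (∣ˡ-respʳ-≈ (factor (S ^ₚ m) (Ψ *ₚ Ψ) (S ^ₚ q)) (_≡_mod_.difference congruence)))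
  where
  open Mod (C (+ p))
  open FibonacciMod pp
  m n q : ℕ
  m = p ^ k
  n = p ^ suc k
  q = φ n
  regroup : ∀ f ψ s → (f *ₚ ψ) *ₚ (f *ₚ ψ) *ₚ s ≋ f *ₚ f *ₚ s *ₚ (ψ *ₚ ψ)
  regroup = solve-∀ polyACR
  congruence : S ^ₚ m *ₚ (Ψ *ₚ Ψ) ≡ S ^ₚ q *ₚ S ^ₚ m mod C (+ p)
  congruence = mod-trans (mod-* (S*F²-mod k) (≋⇒mod refl)) (mod-trans
    (≋⇒mod (trans (sym (regroup (F m) Ψ S)) (*-cong (*-cong e e) refl)))
    (mod-trans (mod-sym (S*F²-mod (suc k))) (≋⇒mod (trans
      (≡.subst (λ t → S ^ₚ n ≋ S ^ₚ t) (≡.sym (φ-prime-power pp k)) refl) (^ₚ-+ S q m)))))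
    where
    e : F m *ₚ Ψ ≋ F n
    e = fibotomic-prime-power pp k fib
  factor : ∀ a b c → a *ₚ b +ₚ -ₚ (c *ₚ a) ≋ a *ₚ (b +ₚ -ₚ c)
  factor = solve-∀ polyACR

-- As p is prime in ℤ[x], it divides `f` - `g` or `f` + `g`. In the second case monicity forces p to
-- divide 2, and then the sum and the difference agree modulo p.
monic-square-root-mod : ∀ {p} → Prime p → ∀ f g → Monic f → Monic g →
  C (+ p) ∣ᴾ f *ₚ f +ₚ -ₚ (g *ₚ g) → C (+ p) ∣ᴾ f +ₚ -ₚ g
monic-square-root-mod {p} pp f g mf mg p∣ =
  [ id , opposite ]′ (C-prime pp (f +ₚ -ₚ g) (f +ₚ g) (∣ˡ-respʳ-≈ (factor f g) p∣))
  where
  factor : ∀ f g → f *ₚ f +ₚ -ₚ (g *ₚ g) ≋ (f +ₚ -ₚ g) *ₚ (f +ₚ g)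
  factor = solve-∀ polyACR
  eq : ∀ f g → g *ₚ C (+ 2) +ₚ (f +ₚ -ₚ g) ≋ f +ₚ g
  eq = solve-∀ polyACR
  opposite : C (+ p) ∣ᴾ f +ₚ g → C (+ p) ∣ᴾ f +ₚ -ₚ g
  opposite p∣f+g = ∣-cancel-+ (eq f g) (∣-* g (coeff-∣ (C (+ 2)) p∣2)) p∣f+g
    where
    p∣2 : ∀ i → + p ℤS.∣ coeff (C (+ 2)) i
    p∣2 zero = monic-sum-∣ pp f g mf mg p∣f+g
    p∣2 (suc i) = ℤS.divides (+ 0) ≡.refl

theorem5p1 : (p k : ℕ) → Prime p → 1 ≤ k → (Ψ : Poly) → IsFibotomic (p ^ k) Ψ →
    (2 ∣ φ (p ^ k) → ModEq p Ψ ((+ 4 ∷ + 0 ∷ + 1 ∷ []) ^ₚ (φ (p ^ k) / 2)))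
    × ModEq p (Ψ *ₚ Ψ) ((+ 4 ∷ + 0 ∷ + 1 ∷ []) ^ₚ φ (p ^ k))
theorem5p1 p (suc k) pp _ Ψ fib = (λ 2∣q → ∣⇒ModEq {f = Ψ} (root 2∣q)) , ∣⇒ModEq {f = Ψ *ₚ Ψ} square
  where
  q : ℕ
  q = φ (p ^ suc k)
  square : C (+ p) ∣ᴾ Ψ *ₚ Ψ +ₚ -ₚ (S ^ₚ q)
  square = fibotomic²-mod pp k {Ψ} fib
  root : 2 ∣ q → C (+ p) ∣ᴾ Ψ +ₚ -ₚ (S ^ₚ (q / 2))
  root 2∣q = monic-square-root-mod pp Ψ (S ^ₚ (q / 2)) (proj₁ fib) (monic-^ S S-monic (q / 2))
    (∣ˡ-respʳ-≈ (+-congˡ {Ψ *ₚ Ψ} (scale-cong (ℤ.- + 1) Sᑫ)) square)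
    where
    2*half : q ≡ q / 2 ℕ.+ q / 2
    2*half = ≡.trans (≡.sym (m/n*n≡m 2∣q)) (≡.trans (ℕP.*-comm (q / 2) 2) (≡.cong (q / 2 ℕ.+_) (ℕP.+-identityʳ (q / 2))))
    Sᑫ : S ^ₚ q ≋ S ^ₚ (q / 2) *ₚ S ^ₚ (q / 2)
    Sᑫ = trans (≡.subst (λ t → S ^ₚ q ≋ S ^ₚ t) 2*half refl) (^ₚ-+ S (q / 2) (q / 2))
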